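{- Let $G=\langle G,\cdot,1\rangle$ be a definable group with $G\subseteq M^n$ and $\dim G=k$. Suppose that (i) $X\subseteq M^m$ and $Z\subseteq X^2$ are two $\mathcal L$-definable sets with $\dim(X^2\setminus Z)<2k$; (ii) $h:X\to G$ is a definable injective map with $\dim(G\setminus h(X))<k$; (iii) $F:X^2\to X$ is an $\mathcal L$-definable map such that for every $(x,y)\in Z$, $h(x)\cdot h(y)=h(F(x,y))$. Then $G$ is definably isomorphic to an $\mathcal L$-interpretable group. If, moreover, $\mathcal M$ is o-minimal, then $G$ is definably isomorphic to an $\mathcal L$-definable group.
   Context: Let $\mathcal M$ and $\mathcal N$ be arbitrary first-order structures, with $\mathcal N$ expanding $\mathcal M$; $\mathcal L$ is the language of $\mathcal M$. "$\mathcal L$-definable" means definable in $\mathcal M$ with parameters; "definable" means definable in $\mathcal N$ with parameters. ($\mathcal M$ is not assumed o-minimal.) Assume there is a map $\dim$ from the class of all definable sets to $\{ -\infty\}\cup\mathbb N$ such that for all definable $X,Y\subseteq M^n$ and $a\in M$: (D1) $\dim\{a\}=1$ [as stated in the paper], $\dim M=1$, and $\dim X=-\infty$ iff $X=\emptyset$; (D2) $\dim(X\cup Y)=\max\{\dim X,\dim Y\}$; (D3b) if $\{X_t\}_{t\in I}$ is a disjoint definable family of sets each of dimension $k$, then $\dim\bigcup_{t\in I}X_t=\dim I+k$; (D4) if $f:X\to Y$ is a definable bijection then $\dim X=\dim Y$; (Ldef) if $\{X_t\}_{t\in I}$ is an $\mathcal L$-definable disjoint family, then for each $d$ the set $I_d=\{t\in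 I:\dim X_t=d\}$ is $\mathcal L$-definable. A definable quotient is $X/E$ for a definable set $X$ and a definable equivalence relation $E$; a map $f:X/E_1\to Y/E_2$ is definable if $\{(x,y)\in X\times Y: f([x])=[y]\}$ is definable; an interpretable group is a group whose universe is a definable quotient and whose operation is a definable map. "$\mathcal L$-interpretable"/"$\mathcal L$-definable" refer to these notions in $\mathcal M$, and "definably isomorphic" means via a map definable in $\mathcal N$.
   Formalization: In (D1) the value of dim{a} is taken to be 0 instead of the printed 1, since dim{a}=1 contradicts (D3b) for the family of singletons of M together with dim M=1; the value 0 already follows from the other axioms. -}

module Defs where

open import Level using (Level; suc)
open import Algebra.Bundles using (Group)
open import Algebra.Core using (Op₁; Op₂)
open import Algebra.Morphism.Structures using (module GroupMorphisms)
open import Algebra.Structures using (IsGroup)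
open import Data.Empty.Polymorphic using (⊥)
open import Data.Fin.Base using (Fin)
open import Data.List.Base using (List)
open import Data.List.Relation.Unary.Any using (Any)
open import Data.Nat.Base using (ℕ; _+_; _<_; _⊔_) renaming (suc to 1+_)
open import Data.Product.Base using (Σ; ∃; _×_; _,_; proj₁; proj₂)
open import Data.Sum.Base using (_⊎_)
open import Data.Unit.Polymorphic using (⊤)
open import Data.Vec.Base using (Vec; []; _∷_; _++_; lookup; take; drop)
open import Function.Base using (_on_)
open import Function.Bundles using (_⇔_)
open import Function.Definitions using (Congruent; Injective; Bijective)
open import Relation.Binary.Bundles using (Setoid)
open import Relation.Binary.Core using () renaming (Rel to BinRel)
open import Relation.Binary.Structures using (IsEquivalence; IsStrictTotalOrder)
open import Relation.Binary.PropositionalEquality.Core using (_≡_)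
open import Relation.Binary.PropositionalEquality.Properties using (isEquivalence)
open import Relation.Nullary.Construct.Add.Infimum using (_₋; ⊥₋; [_])
open import Relation.Nullary.Construct.Add.Extrema using (_±)
open import Relation.Nullary.Negation.Core using (¬_)
open import Relation.Unary using (Pred; Empty; _≐_; _∪_)
import Relation.Binary.Construct.On as On
import Relation.Binary.Construct.Add.Extrema.Strict as ExtremaStrict
import Relation.Binary.Construct.Add.Infimum.Strict as InfimumStrict
import Relation.Nullary.Construct.Add.Extrema as Extrema

private variable
  ℓ : Level
  l m n p : ℕ

record Language (ℓ : Level) : Set (suc ℓ) where
  field
    Fun : ℕ → Set ℓ
    Rel : ℕ → Set ℓ

data Term (L : Language ℓ) (n : ℕ) : Set ℓ where
  var : Fin n → Term L n
  fun : ∀ {k} → Language.Fun L k → Vec (Term L n) k → Term L n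

-- The quantifiers bind de Bruijn index 0.
data Formula (L : Language ℓ) (n : ℕ) : Set ℓ where
  _≈′_           : Term L n → Term L n → Formula L n
  rel            : ∀ {k} → Language.Rel L k → Vec (Term L n) k → Formula L n
  ⊥′             : Formula L n
  _∧′_ _∨′_ _⇒′_ : Formula L n → Formula L n → Formula L n
  ∀′ ∃′          : Formula L (1+ n) → Formula L n

record Structure (L : Language ℓ) (A : Set ℓ) : Set (suc ℓ) where
  field
    funᴵ : ∀ {k} → Language.Fun L k → Vec A k → A
    relᴵ : ∀ {k} → Language.Rel L k → Vec A k → Set ℓ

module _ {L : Language ℓ} {A : Set ℓ} (S : Structure L A) where
  open Structure S

  mutual
    eval : Vec A n → Term L n → A
    eval ρ (var i)    = lookup ρ i
    eval ρ (fun f ts) = funᴵ f (evals ρ ts)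

    evals : ∀ {k} → Vec A n → Vec (Term L n) k → Vec A k
    evals ρ []       = []
    evals ρ (t ∷ ts) = eval ρ t ∷ evals ρ ts

  Sat : Vec A n → Formula L n → Set ℓ
  Sat ρ (s ≈′ t)   = eval ρ s ≡ eval ρ t
  Sat ρ (rel r ts) = relᴵ r (evals ρ ts)
  Sat ρ ⊥′         = ⊥
  Sat ρ (φ ∧′ ψ)   = Sat ρ φ × Sat ρ ψ
  Sat ρ (φ ∨′ ψ)   = Sat ρ φ ⊎ Sat ρ ψ
  Sat ρ (φ ⇒′ ψ)   = Sat ρ φ → Sat ρ ψ
  Sat ρ (∀′ φ)     = ∀ a → Sat (a ∷ ρ) φ
  Sat ρ (∃′ φ)     = ∃ λ a → Sat (a ∷ ρ) φ

record Expands {L L′ : Language ℓ} {A : Set ℓ} (N : Structure L′ A) (M : Structure L A) : Set ℓ where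
  open Structure
  field
    onFun           : ∀ {k} → Language.Fun L k → Language.Fun L′ k
    onRel           : ∀ {k} → Language.Rel L k → Language.Rel L′ k
    onFun-injective : ∀ {k} → Injective _≡_ _≡_ (onFun {k})
    onRel-injective : ∀ {k} → Injective _≡_ _≡_ (onRel {k})
    fun-agrees      : ∀ {k} (f : Language.Fun L k) xs → funᴵ N (onFun f) xs ≡ funᴵ M f xs
    rel-agrees      : ∀ {k} (r : Language.Rel L k) xs → relᴵ N (onRel r) xs ⇔ relᴵ M r xs

Subset : Set ℓ → ℕ → Set (suc ℓ)
Subset {ℓ} A n = Pred (Vec A n) ℓ

module _ {A : Set ℓ} where

  -- {(x , y) : R x y} as a subset of A^(m+n)
  ⟪_⟫ : (Vec A m → Vec A n → Set ℓ) → Subset A (m + n)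
  ⟪_⟫ {m = m} R z = R (take m z) (drop m z)

  -- {(x , y , z) : R x y z} as a subset of A^(l+(m+n))
  ⟪_⟫₃ : (Vec A l → Vec A m → Vec A n → Set ℓ) → Subset A (l + (m + n))
  ⟪ R ⟫₃ = ⟪ (λ x → ⟪ R x ⟫) ⟫

  module _ {L : Language ℓ} (S : Structure L A) where

    Definable : Subset A n → Set ℓ
    Definable {n} X =
      ∃ λ p → Σ (Vec A p) λ a → Σ (Formula L (p + n)) λ φ →
      ∀ x → X x ⇔ Sat S (a ++ x) φ

    record DefinableFamily (I : Subset A p) (X : Vec A p → Subset A n) : Set ℓ where
      field
        index : Definable I
        total : Definable ⟪ (λ t x → I t × X t x) ⟫

  Disjoint : Subset A p → (Vec A p → Subset A n) → Set ℓ
  Disjoint I X = ∀ {s t x} → I s → I t → X s x → X t x → s ≡ t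

  ⋃ : Subset A p → (Vec A p → Subset A n) → Subset A n
  ⋃ I X x = ∃ λ t → I t × X t x

-- X/E, represented by the setoid with carrier X and equality E.  Only the
-- restriction of _∼_ to Universe matters.
record Quotient (A : Set ℓ) (n : ℕ) : Set (suc ℓ) where
  field
    Universe      : Subset A n
    _∼_           : Vec A n → Vec A n → Set ℓ
    ∼-equivalence : IsEquivalence (_∼_ on proj₁ {B = Universe})

  setoid : Setoid ℓ ℓ
  setoid = record { Carrier = ∃ Universe ; _≈_ = _∼_ on proj₁ ; isEquivalence = ∼-equivalence }

  open Setoid setoid public using (Carrier; _≈_)

module _ {A : Set ℓ} where
  open Quotient

  -- A subset is identified with its quotient by equality.
  ⌊_⌋ : Subset A n → Quotient A n
  ⌊ X ⌋ = record { Universe = X ; _∼_ = _≡_ ; ∼-equivalence = On.isEquivalence proj₁ isEquivalence }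

  IsMap : (P : Quotient A m) (Q : Quotient A n) → (Carrier P → Carrier Q) → Set ℓ
  IsMap P Q f = Congruent (_≈_ P) (_≈_ Q) f

  IsMap₂ : (P : Quotient A m) (Q : Quotient A n) → (Carrier P → Carrier P → Carrier Q) → Set ℓ
  IsMap₂ P Q f = ∀ {x x′ y y′} → _≈_ P x x′ → _≈_ P y y′ → _≈_ Q (f x y) (f x′ y′)

  -- {(x , y) ∈ X × Y : f [x] = [y]}
  Graph : (P : Quotient A m) (Q : Quotient A n) → (Carrier P → Carrier Q) → Subset A (m + n)
  Graph P Q f = ⟪ (λ x y → Σ (Universe P x) λ x∈ → Σ (Universe Q y) λ y∈ → _≈_ Q (f (x , x∈)) (y , y∈)) ⟫

  -- {(x , y , z) ∈ X × X × Z : f ([x] , [y]) = [z]}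
  Graph₂ : (P : Quotient A m) (Q : Quotient A n) → (Carrier P → Carrier P → Carrier Q) → Subset A (m + (m + n))
  Graph₂ P Q f =
    ⟪ (λ x y z → Σ (Universe P x) λ x∈ → Σ (Universe P y) λ y∈ → Σ (Universe Q z) λ z∈ →
                 _≈_ Q (f (x , x∈) (y , y∈)) (z , z∈)) ⟫₃

  module _ {L : Language ℓ} (S : Structure L A) where

    record DefinableQuotient (Q : Quotient A n) : Set ℓ where
      field
        universe-definable : Definable S (Universe Q)
        ∼-definable        : Definable S ⟪ (λ x y → Universe Q x × Universe Q y × _∼_ Q x y) ⟫

    record DefinableMap (P : Quotient A m) (Q : Quotient A n) (f : Carrier P → Carrier Q) : Set ℓ where
      field
        isMap           : IsMap P Q f
        graph-definable : Definable S (Graph P Q f)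

    record DefinableMap₂ (P : Quotient A m) (Q : Quotient A n) (f : Carrier P → Carrier P → Carrier Q) : Set ℓ where
      field
        isMap₂          : IsMap₂ P Q f
        graph-definable : Definable S (Graph₂ P Q f)

record GroupOn {A : Set ℓ} (Q : Quotient A n) : Set ℓ where
  open Quotient Q
  infixl 7 _∙_
  field
    _∙_     : Op₂ Carrier
    ε       : Carrier
    _⁻¹     : Op₁ Carrier
    isGroup : IsGroup _≈_ _∙_ ε _⁻¹

  group : Group ℓ ℓ
  group = record { isGroup = isGroup }

  open Group group public using (rawGroup)

module _ {A : Set ℓ} {L : Language ℓ} (S : Structure L A) where

  record InterpretableGroup {Q : Quotient A n} (G : GroupOn Q) : Set ℓ where
    field
      universe-definable : DefinableQuotient S Q
      ∙-definable        : DefinableMap₂ S Q Q (GroupOn._∙_ G)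

  record DefinableGroup {X : Subset A n} (G : GroupOn ⌊ X ⌋) : Set ℓ where
    field
      universe-definable : Definable S X
      ∙-definable        : DefinableMap₂ S ⌊ X ⌋ ⌊ X ⌋ (GroupOn._∙_ G)

  DefinablyIsomorphic : {P : Quotient A m} {Q : Quotient A n} → GroupOn P → GroupOn Q → Set ℓ
  DefinablyIsomorphic {P = P} {Q = Q} G H =
    ∃ λ f → IsGroupIsomorphism f × DefinableMap S P Q f
    where open GroupMorphisms (GroupOn.rawGroup G) (GroupOn.rawGroup H)

-- {-∞} ∪ ℕ, with ⊥₋ standing for -∞
Dim : Set
Dim = ℕ ₋

open InfimumStrict _<_ public using () renaming (_<₋_ to _<ᴰ_)

_⊔ᴰ_ : Dim → Dim → Dim
⊥₋    ⊔ᴰ e     = e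
[ d ] ⊔ᴰ ⊥₋    = [ d ]
[ d ] ⊔ᴰ [ e ] = [ d ⊔ e ]

_+ᴰ_ : Dim → Dim → Dim
⊥₋    +ᴰ _     = ⊥₋
[ _ ] +ᴰ ⊥₋    = ⊥₋
[ d ] +ᴰ [ e ] = [ d + e ]

record Dimension {L L′ : Language ℓ} {A : Set ℓ} (M : Structure L A) (N : Structure L′ A) : Set (suc ℓ) where
  field
    dim      : {X : Subset A n} → Definable N X → Dim
    -- dim depends only on the set, not on its definition.
    dim-cong : {X Y : Subset A n} (X-def : Definable N X) (Y-def : Definable N Y) →
               X ≐ Y → dim X-def ≡ dim Y-def

  HasDim : Subset A n → Dim → Set ℓ
  HasDim X d = Σ (Definable N X) λ X-def → dim X-def ≡ d

  HasDim< : Subset A n → Dim → Set ℓ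
  HasDim< X d = Σ (Definable N X) λ X-def → dim X-def <ᴰ d

  field
    -- The source prints dim {a} = 1, a misprint: D3b for the family
    -- ({t})_{t ∈ M}, with D4 and dim M = 1, forces dim {a} = 0.
    D1-point : (a : A) → HasDim (λ x → x ≡ a ∷ []) [ 0 ]
    D1-line  : HasDim {n = 1} (λ _ → ⊤) [ 1 ]
    D1-empty : {X : Subset A n} → Definable N X → HasDim X ⊥₋ ⇔ Empty X
    D2       : ∀ {X Y : Subset A n} {d e} → HasDim X d → HasDim Y e → HasDim (X ∪ Y) (d ⊔ᴰ e)
    D3b      : ∀ {I : Subset A p} {X : Vec A p → Subset A n} {d k} →
               DefinableFamily N I X → Disjoint I X →
               HasDim I d → (∀ t → I t → HasDim (X t) k) →
               HasDim (⋃ I X) (d +ᴰ k)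
    D4       : ∀ {X : Subset A m} {Y : Subset A n} {d e} → HasDim X d → HasDim Y e →
               (f : ∃ X → ∃ Y) → DefinableMap N ⌊ X ⌋ ⌊ Y ⌋ f →
               Bijective (Quotient._≈_ ⌊ X ⌋) (Quotient._≈_ ⌊ Y ⌋) f →
               d ≡ e
    Ldef     : {I : Subset A p} {X : Vec A p → Subset A n} →
               DefinableFamily M I X → Disjoint I X →
               ∀ d → Definable M (λ t → I t × HasDim (X t) d)

data Cell (A : Set ℓ) : Set ℓ where
  point    : A → Cell A
  interval : A ± → A ± → Cell A

module _ {A : Set ℓ} (_≺_ : BinRel A ℓ) where
  open ExtremaStrict _≺_ using (_<±_)

  _∈ᶜ_ : A → Cell A → Set ℓ
  x ∈ᶜ point a      = x ≡ a
  x ∈ᶜ interval a b = a <± Extrema.[ x ] × Extrema.[ x ] <± b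

-- The order is not required to be dense or without endpoints.
record OMinimal {L : Language ℓ} {A : Set ℓ} (M : Structure L A) : Set (suc ℓ) where
  field
    lt : Language.Rel L 2

  _≺_ : BinRel A ℓ
  x ≺ y = Structure.relᴵ M lt (x ∷ y ∷ [])

  field
    ≺-isStrictTotalOrder : IsStrictTotalOrder _≡_ _≺_
    definable⇒cells      : {X : Subset A 1} → Definable M X →
                           Σ (List (Cell A)) λ cs → ∀ x → X (x ∷ []) ⇔ Any (_∈ᶜ_ _≺_ x) cs

{-# OPTIONS --safe #-}

-- Let X′ be the set of x ∈ X with (a , x) ∈ Z for generic a; by (Ldef) it is L-definable, and h(X′)
-- is still large in G.  For x₁ , … , xᵣ ∈ X′ and generic a the elements a , F(a , x₁) ,
-- F(F(a , x₁) , x₂) , … stay inside Z, so h(a)h(x₁)⋯h(xᵣ) = h(a · x₁ · … · xᵣ) with iterated F.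
-- Hence h(x₁)⋯h(xᵣ) = h(y₁)⋯h(yₛ) is an L-definable relation: some a has such chains along both
-- words with the same end.  As h(X′) is large, dimension theory covers G by finitely many
-- translates h(bᵢ)h(X′) with bᵢ ∈ X′.  So G is in bijection with a set of pairs (bᵢ , x), one for
-- each element; that set and the transported operation are L-definable, and this one group
-- serves both claims.

module Submission where

open import Defs
import Algebra.Morphism.GroupMonomorphism as GroupMonomorphism
import Algebra.Properties.Group as GroupProperties
open import Algebra.Bundles using (Group; RawGroup)
open import Algebra.Morphism.Structures using (module GroupMorphisms)
open import Axiom.ExcludedMiddle using (ExcludedMiddle)
open import Data.Empty.Polymorphic using (⊥)
open import Data.Fin.Base using (Fin; zero; suc; lift; _↑ˡ_; _↑ʳ_; splitAt)
open import Data.List.Base using (List; []; _∷_; map) renaming (_++_ to _++ˡ_)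
import Data.List.Relation.Unary.Any as Any
open import Data.List.Relation.Unary.All using (All; []; _∷_)
open import Data.List.Relation.Unary.Any using (Any; here; there)
open import Data.List.Relation.Unary.Any.Properties using (map⁺)
open import Data.Nat.Base using (ℕ; zero; suc; _+_; _*_; _<_; s≤s)
open import Data.Nat.Properties using (<-irrefl; ≤-<-trans; <-≤-trans; ≤∧≢⇒<; n<1+n; ⊔-lub; ⊔-sel; m⊔n≡n⇒m≤n)
open import Data.Nat.Properties using (+-identityʳ; +-comm; +-cancelʳ-<; +-monoʳ-<)
open import Data.Product.Base using (Σ; ∃; _×_; _,_; proj₁; proj₂)
open import Data.Product.Function.NonDependent.Propositional using (_×-⇔_)
open import Data.Sum.Base using (_⊎_; inj₁; inj₂; [_,_]′)
open import Data.Sum.Function.Propositional using (_⊎-⇔_)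
open import Data.Vec.Base using (Vec; []; _∷_; _++_; lookup; take; drop)
open import Data.Vec.Properties using (lookup-++ˡ; lookup-++ʳ; take++drop≡id; ++-injectiveˡ; ++-injectiveʳ)
open import Function.Base using (id; _∘_; case_of_)
open import Function.Bundles using (_⇔_; mk⇔; module Equivalence)
open import Function.Construct.Composition using (_⇔-∘_)
open import Function.Construct.Identity using (⇔-id)
open import Function.Construct.Symmetry using (⇔-sym)
open import Function.Definitions using (Injective)
import Level
import Relation.Binary.Construct.Add.Infimum.Strict as InfimumStrict
open import Relation.Binary.PropositionalEquality using (_≡_; _≢_; refl; sym; trans; cong; cong₂; subst; subst₂)
open import Relation.Nullary.Construct.Add.Infimum using (⊥₋; [_]; []-injective)
open import Relation.Nullary.Decidable.Core using (yes; no)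
open import Relation.Nullary.Negation.Core using (¬_; contradiction)
open import Relation.Unary using (_⊆_; _≐_; _∪_)

open Equivalence using (to; from)
open InfimumStrict _<_ using (⊥₋<[_]; [_])

private variable
  m n p q k : ℕ

-- Logical equivalences, and vectors read along index maps.

→-⇔ : ∀ {a b c d} {P : Set a} {Q : Set b} {R : Set c} {S : Set d} →
      P ⇔ Q → R ⇔ S → (P → R) ⇔ (Q → S)
→-⇔ f g = mk⇔ (λ h → to g ∘ h ∘ from f) (λ h → from g ∘ h ∘ to f)

∀-⇔ : ∀ {a b c} {P : Set a} {Q : P → Set b} {R : P → Set c} →
      (∀ x → Q x ⇔ R x) → (∀ x → Q x) ⇔ (∀ x → R x)
∀-⇔ f = mk⇔ (λ h x → to (f x) (h x)) (λ h x → from (f x) (h x))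

∃-⇔ : ∀ {a b c} {P : Set a} {Q : P → Set b} {R : P → Set c} →
      (∀ x → Q x ⇔ R x) → ∃ Q ⇔ ∃ R
∃-⇔ f = mk⇔ (λ (x , y) → x , to (f x) y) (λ (x , y) → x , from (f x) y)

≡-⇔ : ∀ {a} {P : Set a} {x x′ y y′ : P} → x ≡ x′ → y ≡ y′ → (x ≡ y) ⇔ (x′ ≡ y′)
≡-⇔ refl refl = ⇔-id _

≡⇒⇔ : ∀ {a} {P Q : Set a} → P ≡ Q → P ⇔ Q
≡⇒⇔ refl = ⇔-id _

module _ {a} {A : Set a} where

  take-++ : (x : Vec A m) (y : Vec A n) → take m (x ++ y) ≡ x
  take-++ {m = m} x y = ++-injectiveˡ _ x (take++drop≡id m (x ++ y))

  drop-++ : (x : Vec A m) (y : Vec A n) → drop m (x ++ y) ≡ y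
  drop-++ {m = m} x y = ++-injectiveʳ (take m (x ++ y)) x (take++drop≡id m (x ++ y))

  take-drop-injective : {x y : Vec A (m + n)} → take m x ≡ take m y → drop m x ≡ drop m y → x ≡ y
  take-drop-injective {m = m} {x = x} {y} p q =
    trans (sym (take++drop≡id m x)) (trans (cong₂ _++_ p q) (take++drop≡id m y))

  lookup-injective : {x y : Vec A m} → (∀ i → lookup x i ≡ lookup y i) → x ≡ y
  lookup-injective {x = []}    {[]}    h = refl
  lookup-injective {x = _ ∷ _} {_ ∷ _} h = cong₂ _∷_ (h zero) (lookup-injective (h ∘ suc))

join : (Fin m → Fin p) → (Fin n → Fin p) → Fin (m + n) → Fin p
join {m = m} f g i = [ f , g ]′ (splitAt m i)

module _ {a} {A : Set a} where

  infix 4 _≗⟨_⟩_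

  -- A record rather than a bare function type, so that `x`, `σ` and `z` can be inferred from a
  -- proof.
  record _≗⟨_⟩_ (x : Vec A m) (σ : Fin m → Fin n) (z : Vec A n) : Set a where
    constructor pointwise
    field at : ∀ i → lookup x i ≡ lookup z (σ i)

  open _≗⟨_⟩_ public

  ≗-refl : {x : Vec A m} → x ≗⟨ id ⟩ x
  ≗-refl = pointwise λ _ → refl

  ≗-trans : {x : Vec A m} {y : Vec A n} {z : Vec A p} {σ : Fin m → Fin n} {τ : Fin n → Fin p} →
            x ≗⟨ σ ⟩ y → y ≗⟨ τ ⟩ z → x ≗⟨ τ ∘ σ ⟩ z
  ≗-trans {σ = σ} p q = pointwise λ i → trans (at p i) (at q (σ i))

  ≗-↑ˡ : (x : Vec A m) (y : Vec A n) → x ≗⟨ _↑ˡ n ⟩ x ++ y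
  ≗-↑ˡ x y = pointwise λ i → sym (lookup-++ˡ x y i)

  ≗-↑ʳ : (x : Vec A m) (y : Vec A n) → y ≗⟨ m ↑ʳ_ ⟩ x ++ y
  ≗-↑ʳ x y = pointwise λ i → sym (lookup-++ʳ x y i)

  ≗-join : {x : Vec A m} {y : Vec A n} {z : Vec A p} {f : Fin m → Fin p} {g : Fin n → Fin p} →
           x ≗⟨ f ⟩ z → y ≗⟨ g ⟩ z → x ++ y ≗⟨ join f g ⟩ z
  ≗-join {x = x} {y} {z} p q = pointwise (go x (at p) (at q))
    where
    go : ∀ {k} (x : Vec A k) {f g} → (∀ i → lookup x i ≡ lookup z (f i)) → (∀ i → lookup y i ≡ lookup z (g i)) →
         ∀ i → lookup (x ++ y) i ≡ lookup z (join f g i)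
    go []      p q i       = q i
    go (_ ∷ x) p q zero    = p zero
    go {suc k} (_ ∷ x) {f} {g} p q (suc i) with splitAt k i | go x {f ∘ suc} {g} (p ∘ suc) q i
    ... | inj₁ _ | e = e
    ... | inj₂ _ | e = e

  ≗-lift : {x : Vec A m} {z : Vec A n} {σ : Fin m → Fin n} → x ≗⟨ σ ⟩ z → ∀ a → a ∷ x ≗⟨ lift 1 σ ⟩ a ∷ z
  ≗-lift p a = pointwise λ { zero → refl ; (suc i) → at p i }

-- Renaming of variables and translation of formulas into an expansion.

module _ {ℓ} {L : Language ℓ} {A : Set ℓ} {M : Structure L A} where

  -- Makes plain renaming of variables a special case of translation along an expansion, so one
  -- induction on formulas covers both.
  Expands-refl : Expands M M
  Expands-refl = record
    { onFun = id ; onRel = id ; onFun-injective = id ; onRel-injective = id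
    ; fun-agrees = λ _ _ → refl ; rel-agrees = λ _ _ → ⇔-id _ }

module _ {ℓ} {L L′ : Language ℓ} {A : Set ℓ} {M : Structure L A} {N : Structure L′ A} (N⊒M : Expands N M) where
  open Expands N⊒M
  open Structure

  mutual
    reindexTerm : (Fin m → Fin n) → Term L m → Term L′ n
    reindexTerm σ (var i)    = var (σ i)
    reindexTerm σ (fun f ts) = fun (onFun f) (reindexTerms σ ts)

    reindexTerms : (Fin m → Fin n) → Vec (Term L m) p → Vec (Term L′ n) p
    reindexTerms σ []       = []
    reindexTerms σ (t ∷ ts) = reindexTerm σ t ∷ reindexTerms σ ts

  reindex : (Fin m → Fin n) → Formula L m → Formula L′ n
  reindex σ (s ≈′ t)   = reindexTerm σ s ≈′ reindexTerm σ t
  reindex σ (rel r ts) = rel (onRel r) (reindexTerms σ ts)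
  reindex σ ⊥′         = ⊥′
  reindex σ (φ ∧′ ψ)   = reindex σ φ ∧′ reindex σ ψ
  reindex σ (φ ∨′ ψ)   = reindex σ φ ∨′ reindex σ ψ
  reindex σ (φ ⇒′ ψ)   = reindex σ φ ⇒′ reindex σ ψ
  reindex σ (∀′ φ)     = ∀′ (reindex (lift 1 σ) φ)
  reindex σ (∃′ φ)     = ∃′ (reindex (lift 1 σ) φ)

  module _ (σ : Fin m → Fin n) {ρ : Vec A m} {ρ′ : Vec A n} (eq : ρ ≗⟨ σ ⟩ ρ′) where
    mutual
      eval-reindex : ∀ t → eval M ρ t ≡ eval N ρ′ (reindexTerm σ t)
      eval-reindex (var i)    = at eq i
      eval-reindex (fun f ts) =
        trans (sym (fun-agrees f _)) (cong (funᴵ N (onFun f)) (evals-reindex ts))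

      evals-reindex : (ts : Vec (Term L m) p) → evals M ρ ts ≡ evals N ρ′ (reindexTerms σ ts)
      evals-reindex []       = refl
      evals-reindex (t ∷ ts) = cong₂ _∷_ (eval-reindex t) (evals-reindex ts)

  Sat-reindex : (σ : Fin m → Fin n) {ρ : Vec A m} {ρ′ : Vec A n} → ρ ≗⟨ σ ⟩ ρ′ →
                ∀ φ → Sat M ρ φ ⇔ Sat N ρ′ (reindex σ φ)
  Sat-reindex σ eq (s ≈′ t)   = ≡-⇔ (eval-reindex σ eq s) (eval-reindex σ eq t)
  Sat-reindex σ eq (rel r ts) =
    ≡⇒⇔ (cong (relᴵ N (onRel r)) (evals-reindex σ eq ts)) ⇔-∘ ⇔-sym (rel-agrees r _)
  Sat-reindex σ eq ⊥′         = ⇔-id _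
  Sat-reindex σ eq (φ ∧′ ψ)   = Sat-reindex σ eq φ ×-⇔ Sat-reindex σ eq ψ
  Sat-reindex σ eq (φ ∨′ ψ)   = Sat-reindex σ eq φ ⊎-⇔ Sat-reindex σ eq ψ
  Sat-reindex σ eq (φ ⇒′ ψ)   = →-⇔ (Sat-reindex σ eq φ) (Sat-reindex σ eq ψ)
  Sat-reindex σ eq (∀′ φ)     = ∀-⇔ λ a → Sat-reindex (lift 1 σ) (≗-lift eq a) φ
  Sat-reindex σ eq (∃′ φ)     = ∃-⇔ λ a → Sat-reindex (lift 1 σ) (≗-lift eq a) φ

  abstract
    Definable-expand : {X : Subset A n} → Definable M X → Definable N X
    Definable-expand (p , a , φ , X⇔φ) =
      p , a , reindex id φ , λ x → Sat-reindex id ≗-refl φ ⇔-∘ X⇔φ x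

-- Tuples assembled from parameters and the coordinates of a context.

-- All coordinates of t : E → A^m are coordinates of V or constants.
record Coordinates {ℓ} {A : Set ℓ} {E : Set ℓ} (V : E → Vec A n) (t : E → Vec A m) : Set ℓ where
  field
    {#params} : ℕ
    params    : Vec A #params
    index     : Fin m → Fin (#params + n)
    correct   : ∀ e → t e ≗⟨ index ⟩ params ++ V e

module _ {ℓ} {A : Set ℓ} where
  open Coordinates

  infixr 5 _◂_

  -- The context under a quantifier over `A^m`: the bound block stands before the old coordinates.
  _◂_ : ∀ m {E : Set ℓ} → (E → Vec A n) → Vec A m × E → Vec A (m + n)
  (m ◂ V) (x , e) = x ++ V e

  module _ {E : Set ℓ} {V : E → Vec A n} where

    infixr 5 _⧺_

    allᶜ : Coordinates V V
    allᶜ = record { params = [] ; index = id ; correct = λ _ → ≗-refl }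

    constᶜ : (a : Vec A m) → Coordinates V (λ _ → a)
    constᶜ a = record { params = a ; index = _↑ˡ n ; correct = λ e → ≗-↑ˡ a (V e) }

    select : {t : E → Vec A m} {s : E → Vec A p} (σ : Fin p → Fin m) → (∀ e → s e ≗⟨ σ ⟩ t e) →
             Coordinates V t → Coordinates V s
    select σ eq c = record
      { params = params c ; index = index c ∘ σ ; correct = λ e → ≗-trans (eq e) (correct c e) }

    takeᶜ : ∀ m {t : E → Vec A (m + p)} → Coordinates V t → Coordinates V (λ e → take m (t e))
    takeᶜ {p = p} m {t} = select (_↑ˡ p) λ e →
      subst (take m (t e) ≗⟨ _↑ˡ p ⟩_) (take++drop≡id m (t e)) (≗-↑ˡ (take m (t e)) (drop m (t e)))

    dropᶜ : ∀ m {t : E → Vec A (m + p)} → Coordinates V t → Coordinates V (λ e → drop m (t e))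
    dropᶜ m {t} = select (m ↑ʳ_) λ e →
      subst (drop m (t e) ≗⟨ m ↑ʳ_ ⟩_) (take++drop≡id m (t e)) (≗-↑ʳ (take m (t e)) (drop m (t e)))

    _⧺_ : {s : E → Vec A m} {t : E → Vec A p} → Coordinates V s → Coordinates V t → Coordinates V (λ e → s e ++ t e)
    _⧺_ {s = s} {t} c d = record
      { params  = b
      ; index   = join (fˡ ∘ index c) (fʳ ∘ index d)
      ; correct = λ e → ≗-join
          (≗-trans (correct c e)
            (≗-join
              (≗-trans (≗-↑ˡ (params c) (params d)) (≗-↑ˡ b (V e))) (≗-↑ʳ b (V e))))
          (≗-trans (correct d e)
            (≗-join
              (≗-trans (≗-↑ʳ (params c) (params d)) (≗-↑ˡ b (V e))) (≗-↑ʳ b (V e)))) }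
      where
      b  = params c ++ params d
      -- Both parameter lists are kept, so each index map is rerouted into its own half of `b`, and
      -- references to `V` are moved past all of `b`.
      fˡ : Fin (#params c + n) → Fin (#params c + #params d + n)
      fˡ = join ((_↑ˡ n) ∘ (_↑ˡ #params d)) ((#params c + #params d) ↑ʳ_)
      fʳ : Fin (#params d + n) → Fin (#params c + #params d + n)
      fʳ = join ((_↑ˡ n) ∘ (#params c ↑ʳ_)) ((#params c + #params d) ↑ʳ_)

    newᶜ : Coordinates (m ◂ V) proj₁
    newᶜ = record { params = [] ; index = _↑ˡ n ; correct = λ (x , e) → ≗-↑ˡ x (V e) }

    oldᶜ : {t : E → Vec A p} → Coordinates V t → Coordinates (m ◂ V) (t ∘ proj₂)
    oldᶜ {m = m} c = record
      { params  = params c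
      ; index   = f ∘ index c
      ; correct = λ (x , e) → ≗-trans (correct c e)
          (≗-join (≗-↑ˡ (params c) (x ++ V e))
            (≗-trans (≗-↑ʳ x (V e)) (≗-↑ʳ (params c) (x ++ V e)))) }
      where
      f : Fin (#params c + n) → Fin (#params c + (m + n))
      f = join (_↑ˡ (m + n)) ((#params c ↑ʳ_) ∘ (m ↑ʳ_))

-- Closure properties of definable relations.

module Definability {ℓ} {L : Language ℓ} {A : Set ℓ} (S : Structure L A) where
  open Coordinates

  -- For V = id this is Definable S P.
  Def : {E : Set ℓ} (V : E → Vec A n) → (E → Set ℓ) → Set ℓ
  Def {n = n} V P =
    ∃ λ p → Σ (Vec A p) λ a → Σ (Formula L (p + n)) λ φ → ∀ e → P e ⇔ Sat S (a ++ V e) φ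

  private
    ren : (Fin m → Fin n) → Formula L m → Formula L n
    ren = reindex (Expands-refl {M = S})

    Sat-ren : (σ : Fin m → Fin n) {ρ : Vec A m} {ρ′ : Vec A n} → ρ ≗⟨ σ ⟩ ρ′ →
              ∀ φ → Sat S ρ φ ⇔ Sat S ρ′ (ren σ φ)
    Sat-ren = Sat-reindex Expands-refl

    ∃ⁿ : ∀ m → Formula L (m + n) → Formula L n
    ∃ⁿ zero    φ = φ
    ∃ⁿ (suc m) φ = ∃ⁿ m (∃′ φ)

    Sat-∃ⁿ : ∀ m (φ : Formula L (m + n)) {ρ} → Sat S ρ (∃ⁿ m φ) ⇔ ∃ λ x → Sat S (x ++ ρ) φ
    Sat-∃ⁿ zero    φ = mk⇔ ([] ,_) (λ { ([] , h) → h })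
    Sat-∃ⁿ (suc m) φ =
      mk⇔ (λ (x , a , h) → a ∷ x , h) (λ { (a ∷ x , h) → x , a , h }) ⇔-∘ Sat-∃ⁿ m (∃′ φ)

    equal : (Fin m → Fin n) → (Fin m → Fin n) → Formula L n
    -- Formulas have no constant for truth; this implication serves as the empty conjunction.
    equal {m = zero}  σ τ = ⊥′ ⇒′ ⊥′
    equal {m = suc m} σ τ = (var (σ zero) ≈′ var (τ zero)) ∧′ equal (σ ∘ suc) (τ ∘ suc)

    Sat-equal : (σ τ : Fin m → Fin n) {ρ : Vec A n} →
                Sat S ρ (equal σ τ) ⇔ (∀ i → lookup ρ (σ i) ≡ lookup ρ (τ i))
    Sat-equal {m = zero}  σ τ = mk⇔ (λ _ ()) (λ _ x → x)
    Sat-equal {m = suc m} σ τ = mk⇔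
      (λ { (p , q) zero → p ; (p , q) (suc i) → to (Sat-equal (σ ∘ suc) (τ ∘ suc)) q i })
      (λ h → h zero , from (Sat-equal (σ ∘ suc) (τ ∘ suc)) (h ∘ suc))

  module _ {E : Set ℓ} {V : E → Vec A n} where
    abstract
      Def-cong : {P Q : E → Set ℓ} → (∀ e → P e ⇔ Q e) → Def V Q → Def V P
      Def-cong P⇔Q (p , a , φ , h) = p , a , φ , λ e → h e ⇔-∘ P⇔Q e

      Def-Sat : {t : E → Vec A m} → Coordinates V t → (φ : Formula L m) → Def V (λ e → Sat S (t e) φ)
      Def-Sat c φ = _ , params c , ren (index c) φ , λ e → Sat-ren (index c) (correct c e) φ

      private
        -- Each formula keeps its own context inside `(a ++ V e) ++ (b ++ V e)`; `Def-Sat` then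
        -- reads this doubled tuple off the single context `V e`.
        binary : {P Q : E → Set ℓ} (f : ∀ {k} → Formula L k → Formula L k → Formula L k) {R : Set ℓ → Set ℓ → Set ℓ} →
                 (∀ {P P′ Q Q′} → P ⇔ P′ → Q ⇔ Q′ → R P Q ⇔ R P′ Q′) →
                 (∀ {k} {ρ : Vec A k} φ ψ → Sat S ρ (f φ ψ) ≡ R (Sat S ρ φ) (Sat S ρ ψ)) →
                 Def V P → Def V Q → Def V (λ e → R (P e) (Q e))
        binary f cong-R sat (p , a , φ , hφ) (q , b , ψ , hψ) =
          Def-cong
            (λ e → ⇔-sym (≡⇒⇔ (sat _ _))
              ⇔-∘ cong-R (Sat-ren (_↑ˡ _) (≗-↑ˡ (a ++ V e) (b ++ V e)) φ ⇔-∘ hφ e)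
                         (Sat-ren ((p + n) ↑ʳ_) (≗-↑ʳ (a ++ V e) (b ++ V e)) ψ ⇔-∘ hψ e))
            (Def-Sat ((constᶜ a ⧺ allᶜ) ⧺ (constᶜ b ⧺ allᶜ)) (f (ren (_↑ˡ _) φ) (ren ((p + n) ↑ʳ_) ψ)))

      infixr 6 _∩ᵈ_
      infixr 5 _∪ᵈ_

      _∩ᵈ_ : {P Q : E → Set ℓ} → Def V P → Def V Q → Def V (λ e → P e × Q e)
      _∩ᵈ_ = binary _∧′_ _×-⇔_ λ _ _ → refl

      _∪ᵈ_ : {P Q : E → Set ℓ} → Def V P → Def V Q → Def V (λ e → P e ⊎ Q e)
      _∪ᵈ_ = binary _∨′_ _⊎-⇔_ λ _ _ → refl

      ∅ᵈ : Def V (λ _ → ⊥)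
      ∅ᵈ = 0 , [] , ⊥′ , λ _ → ⇔-id _

      ∁ᵈ : {P : E → Set ℓ} → Def V P → Def V (λ e → ¬ P e)
      ∁ᵈ (p , a , φ , h) =
        p , a , (φ ⇒′ ⊥′) , λ e → →-⇔ (h e) (mk⇔ (λ ()) λ ())

      substᵈ : {X : Subset A m} {t : E → Vec A m} → Definable S X → Coordinates V t → Def V (λ e → X (t e))
      substᵈ (p , a , φ , h) c = Def-cong (λ e → h _) (Def-Sat (constᶜ a ⧺ c) φ)

      substᵈ₂ : (R : Vec A m → Vec A p → Set ℓ) {s : E → Vec A m} {t : E → Vec A p} → Definable S ⟪ R ⟫ →
                Coordinates V s → Coordinates V t → Def V (λ e → R (s e) (t e))
      substᵈ₂ R {s} {t} d c c′ =
        Def-cong (λ e → ≡⇒⇔ (sym (cong₂ R (take-++ (s e) (t e)) (drop-++ (s e) (t e))))) (substᵈ d (c ⧺ c′))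

      substᵈ₃ : (R : Vec A m → Vec A p → Vec A q → Set ℓ) {s : E → Vec A m} {t : E → Vec A p} {u : E → Vec A q} →
                Definable S ⟪ R ⟫₃ → Coordinates V s → Coordinates V t → Coordinates V u →
                Def V (λ e → R (s e) (t e) (u e))
      substᵈ₃ R {s} {t} {u} d c c′ c″ =
        Def-cong (λ e → ≡⇒⇔ (sym (cong₂ (R (s e)) (take-++ (t e) (u e)) (drop-++ (t e) (u e)))))
          (substᵈ₂ (λ x → ⟪ R x ⟫) d c (c′ ⧺ c″))

      ≡ᵈ : {s t : E → Vec A m} → Coordinates V s → Coordinates V t → Def V (λ e → s e ≡ t e)
      ≡ᵈ {m = m} {s} {t} c c′ =
        Def-cong
          (λ e → ⇔-sym (Sat-equal (_↑ˡ m) (m ↑ʳ_) {s e ++ t e}) ⇔-∘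
                 mk⇔ (λ eq i → trans (lookup-++ˡ (s e) (t e) i) (trans (cong (λ z → lookup z i) eq) (sym (lookup-++ʳ (s e) (t e) i))))
                     (λ h → lookup-injective λ i →
                       trans (sym (lookup-++ˡ (s e) (t e) i)) (trans (h i) (lookup-++ʳ (s e) (t e) i))))
          (Def-Sat (c ⧺ c′) (equal (_↑ˡ m) (m ↑ʳ_)))

  module _ {E : Set ℓ} {V : E → Vec A n} where
    abstract
      ∃ᵈ : {P : Vec A m → E → Set ℓ} → Def (m ◂ V) (λ (x , e) → P x e) → Def V (λ e → ∃ λ x → P x e)
      ∃ᵈ {m = m} {P} (p , a , φ , h) =
        p , a , ∃ⁿ m (ren σ φ) , λ e →
          ⇔-sym (Sat-∃ⁿ m (ren σ φ)) ⇔-∘ ∃-⇔ λ x → Sat-ren σ (swap x (V e)) φ ⇔-∘ h (x , e)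
        where
        -- `∃ⁿ` binds the leading block, so `x` has to be moved in front of the parameters `a`.
        σ : Fin (p + (m + n)) → Fin (m + (p + n))
        σ = join ((m ↑ʳ_) ∘ (_↑ˡ n)) (join (_↑ˡ (p + n)) ((m ↑ʳ_) ∘ (p ↑ʳ_)))
        swap : (x : Vec A m) (v : Vec A n) → a ++ (x ++ v) ≗⟨ σ ⟩ x ++ (a ++ v)
        swap x v = ≗-join
          (≗-trans (≗-↑ˡ a v) (≗-↑ʳ x (a ++ v)))
          (≗-join (≗-↑ˡ x (a ++ v)) (≗-trans (≗-↑ʳ a v) (≗-↑ʳ x (a ++ v))))

-- Order and arithmetic of dimensions.

private variable
  d e f : Dim

<ᴰ-irrefl : ¬ (d <ᴰ d)
<ᴰ-irrefl [ p ] = <-irrefl refl p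

-- The equation `d ⊔ᴰ e ≡ e` plays the role of `d ≤ e`; it is the form in which D2 delivers
-- monotonicity.
⊔ᴰ-bound : d ⊔ᴰ e ≡ e → e <ᴰ [ k ] → d <ᴰ [ k ]
⊔ᴰ-bound {⊥₋}    eq p     = ⊥₋<[ _ ]
⊔ᴰ-bound {[ i ]} {[ j ]} eq [ p ] = [ ≤-<-trans (m⊔n≡n⇒m≤n ([]-injective eq)) p ]

⊔ᴰ-lub : d <ᴰ f → e <ᴰ f → (d ⊔ᴰ e) <ᴰ f
⊔ᴰ-lub ⊥₋<[ _ ] q        = q
⊔ᴰ-lub [ p ]    ⊥₋<[ _ ] = [ p ]
⊔ᴰ-lub [ p ]    [ q ]    = [ ⊔-lub p q ]

⊔ᴰ-≢⇒< : d ⊔ᴰ [ k ] ≡ [ k ] → d ≢ [ k ] → d <ᴰ [ k ]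
⊔ᴰ-≢⇒< {⊥₋}    eq d≢k = ⊥₋<[ _ ]
⊔ᴰ-≢⇒< {[ i ]} eq d≢k = [ ≤∧≢⇒< (m⊔n≡n⇒m≤n ([]-injective eq)) (d≢k ∘ cong [_]) ]

⊔ᴰ-dominant : d ⊔ᴰ e ≡ [ k ] → e <ᴰ [ k ] → d ≡ [ k ]
⊔ᴰ-dominant {⊥₋}    refl q = contradiction q <ᴰ-irrefl
⊔ᴰ-dominant {[ i ]} {⊥₋} eq q = eq
⊔ᴰ-dominant {[ i ]} {[ j ]} {k} eq q with ⊔-sel i j
... | inj₁ p = trans (sym (cong [_] p)) eq
... | inj₂ p = contradiction (subst (_<ᴰ [ k ]) (trans (sym (cong [_] p)) eq) q) <ᴰ-irrefl

+ᴰ-monoʳ-< : ∀ i → e <ᴰ [ k ] → ([ i ] +ᴰ e) <ᴰ [ i + k ]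
+ᴰ-monoʳ-< i ⊥₋<[ _ ] = ⊥₋<[ _ ]
+ᴰ-monoʳ-< i [ p ]    = [ +-monoʳ-< i p ]

+ᴰ-cancelʳ-< : ∀ j {k} → (d +ᴰ [ k ]) <ᴰ [ j + k ] → d <ᴰ [ j ]
+ᴰ-cancelʳ-< {⊥₋}    j p     = ⊥₋<[ _ ]
+ᴰ-cancelʳ-< {[ i ]} j [ p ] = [ +-cancelʳ-< _ i j p ]

-- Consequences of the dimension axioms.

module DimensionProperties {ℓ} {L L′ : Language ℓ} {A : Set ℓ} {M : Structure L A} {N : Structure L′ A} (D : Dimension M N) where
  open Dimension D
  open Definability N

  HasDim-≐ : {X Y : Subset A n} → X ≐ Y → Definable N Y → HasDim X d → HasDim Y d
  HasDim-≐ X≐Y Y-def (X-def , eq) = Y-def , trans (sym (dim-cong X-def Y-def X≐Y)) eq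

  HasDim-unique : {X : Subset A n} → HasDim X d → HasDim X e → d ≡ e
  HasDim-unique (p , refl) (q , refl) = dim-cong p q (id , id)

  -- Here `X ∪ Y` is `Y` itself, so D2 computes its dimension in two ways.
  HasDim-⊆ : {X Y : Subset A n} → X ⊆ Y → HasDim X d → HasDim Y e → d ⊔ᴰ e ≡ e
  HasDim-⊆ X⊆Y hX hY =
    HasDim-unique (HasDim-≐ ((λ { (inj₁ x) → X⊆Y x ; (inj₂ y) → y }) , inj₂) (proj₁ hY) (D2 hX hY)) hY

  HasDim<-⊆ : {X Y : Subset A n} → X ⊆ Y → Definable N X → HasDim< Y [ k ] → HasDim< X [ k ]
  HasDim<-⊆ X⊆Y X-def (Y-def , dY<k) = X-def , ⊔ᴰ-bound (HasDim-⊆ X⊆Y (X-def , refl) (Y-def , refl)) dY<k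

  HasDim<-∪ : {X Y : Subset A n} → HasDim< X d → HasDim< Y d → HasDim< (X ∪ Y) d
  HasDim<-∪ (X-def , p) (Y-def , q) with D2 (X-def , refl) (Y-def , refl)
  ... | XY-def , eq = XY-def , subst (_<ᴰ _) (sym eq) (⊔ᴰ-lub p q)

  HasDim⇒HasDim< : {X : Subset A n} → HasDim X d → d <ᴰ e → HasDim< X e
  HasDim⇒HasDim< (X-def , refl) p = X-def , p

  Image : (Vec A m → Vec A n → Set ℓ) → Subset A m → Subset A n
  Image R X y = ∃ λ x → X x × R x y

  -- D4 for a bijection given by its graph: `total` supplies the function, and functionality
  -- identifies its graph with `R` restricted to `X`, which is definable.
  HasDim-Image : {X : Subset A m} (R : Vec A m → Vec A n → Set ℓ) → Definable N ⟪ R ⟫ →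
                 (∀ {x} → X x → ∃ (R x)) →
                 (∀ {x y y′} → X x → R x y → R x y′ → y ≡ y′) →
                 (∀ {x x′ y} → X x → X x′ → R x y → R x′ y → x ≡ x′) →
                 HasDim X d → HasDim (Image R X) d
  HasDim-Image {X = X} R R-def total functional injective hX@(X-def , eq) =
    image-def , trans (sym (D4 hX (image-def , refl) ⟦_⟧
      record { isMap = λ { {_ , x∈} {_ , x∈′} refl → functional x∈ (proj₂ (total x∈)) (proj₂ (total x∈′)) }
             ; graph-definable = graph-def }
      ((λ { {_ , x∈} {_ , x∈′} eq → injective x∈ x∈′ (proj₂ (total x∈)) (subst (R _) (sym eq) (proj₂ (total x∈′))) })
      , λ { (y , x , x∈ , r) → (x , x∈) , λ { {_ , z∈} refl → functional x∈ (proj₂ (total z∈)) r } }))) refl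
    where
    image-def : Definable N (Image R X)
    image-def = ∃ᵈ (substᵈ X-def newᶜ ∩ᵈ substᵈ₂ R R-def newᶜ (oldᶜ allᶜ))

    ⟦_⟧ : ∃ X → ∃ (Image R X)
    ⟦ x , x∈ ⟧ = proj₁ (total x∈) , x , x∈ , proj₂ (total x∈)

    graph-def : Definable N (Graph ⌊ X ⌋ ⌊ Image R X ⌋ ⟦_⟧)
    graph-def = Def-cong
      (λ z → mk⇔ (λ (x∈ , _ , eq) → x∈ , subst (R _) eq (proj₂ (total x∈)))
                 (λ (x∈ , r) → x∈ , (_ , x∈ , r) , functional x∈ (proj₂ (total x∈)) r))
      (substᵈ X-def (takeᶜ _ allᶜ) ∩ᵈ R-def)

  -- D3b asks for disjoint members, so each fibre `R t` is replaced by its copy over `t`. D4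
  -- preserves its dimension, and the union of the copies is the total set.
  HasDim-fibration : {I : Subset A p} (R : Vec A p → Vec A q → Set ℓ) →
                     Definable N ⟪ (λ t x → I t × R t x) ⟫ → HasDim I d → (∀ t → I t → HasDim (R t) e) →
                     HasDim ⟪ (λ t x → I t × R t x) ⟫ (d +ᴰ e)
  HasDim-fibration {p = p} {q = q} {I = I} R R-def hI hR =
    HasDim-≐ ((λ { (t , t∈ , refl , r) → t∈ , r }) , λ (t∈ , r) → _ , t∈ , refl , r) R-def
      (D3b {X = F} record { index = proj₁ hI ; total = total }
           (λ { _ _ (refl , _) (refl , _) → refl }) hI fibre)
    where
    F : Vec A p → Subset A (p + q)
    F t = ⟪ (λ s x → s ≡ t × R t x) ⟫

    total : Definable N ⟪ (λ t z → I t × F t z) ⟫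
    total = Def-cong (λ z → mk⇔ (λ (t∈ , eq , r) → eq , t∈ , r) (λ (eq , t∈ , r) → t∈ , eq , r))
      (≡ᵈ (takeᶜ p (dropᶜ p allᶜ)) (takeᶜ p allᶜ) ∩ᵈ substᵈ₂ (λ t x → I t × R t x) R-def (takeᶜ p allᶜ) (dropᶜ p (dropᶜ p allᶜ)))

    fibre : ∀ t → I t → HasDim (F t) _
    fibre t t∈ = HasDim-≐
      ((λ { (x , r , refl) → take-++ t x , subst (R t) (sym (drop-++ t x)) r })
      , λ { {z} (refl , r) → drop p z , r , sym (take++drop≡id p z) })
      (≡ᵈ (takeᶜ p allᶜ) (constᶜ t) ∩ᵈ substᵈ (proj₁ (hR t t∈)) (dropᶜ p allᶜ))
      (HasDim-Image (λ x z → z ≡ t ++ x) (≡ᵈ (dropᶜ q allᶜ) (constᶜ t ⧺ takeᶜ q allᶜ))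
        (λ {x} _ → t ++ x , refl) (λ { _ refl refl → refl })
        (λ {x} {x′} _ _ eq eq′ → trans (sym (drop-++ t x)) (trans (cong (drop p) (trans (sym eq) eq′)) (drop-++ t x′)))
        (hR t t∈))

-- Small sets and finite covers by translates in a definable group.

module GroupDimension {ℓ} (em : ExcludedMiddle ℓ)
    {L L′ : Language ℓ} {A : Set ℓ} {M : Structure L A} {N : Structure L′ A} (D : Dimension M N)
    {n} {U : Subset A n} (G : GroupOn ⌊ U ⌋) (G-def : DefinableGroup N G)
    (k : ℕ) (dim-U : Dimension.HasDim D U [ k ]) where
  open Dimension D
  open DimensionProperties D
  open Definability N
  open GroupOn G using (group)
  open Group group using (Carrier; _≈_; _∙_; _⁻¹; _//_; ∙-cong)
  open GroupProperties group using (∙-cancelˡ; ∙-cancelʳ; \\-leftDividesˡ; //-rightDividesˡ)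

  U-def : Definable N U
  U-def = DefinableGroup.universe-definable G-def

  Mul : Vec A n → Vec A n → Vec A n → Set ℓ
  Mul u v w = Σ (U u) λ u∈ → Σ (U v) λ v∈ → Σ (U w) λ w∈ → (u , u∈) ∙ (v , v∈) ≈ (w , w∈)

  Mul-def : Definable N ⟪ Mul ⟫₃
  Mul-def = DefinableMap₂.graph-definable (DefinableGroup.∙-definable G-def)

  mul : ∀ g h {u} → g ∙ h ≈ u → Mul (proj₁ g) (proj₁ h) (proj₁ u)
  mul g h {u} eq = proj₂ g , proj₂ h , proj₂ u , eq

  -- `≈` compares only the underlying vectors, so the membership proofs stored in `Mul` may be
  -- exchanged for any others.
  Mul⇒≈ : ∀ {u v w} u∈ v∈ w∈ → Mul u v w → (u , u∈) ∙ (v , v∈) ≈ (w , w∈)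
  Mul⇒≈ _ _ _ (_ , _ , _ , eq) = trans (∙-cong refl refl) eq

  Mul-functional : ∀ {u v w w′} → Mul u v w → Mul u v w′ → w ≡ w′
  Mul-functional (_ , _ , _ , eq) h = trans (sym eq) (Mul⇒≈ _ _ (proj₁ (proj₂ (proj₂ h))) h)

  Mul-cancelˡ : ∀ {u v v′ w} → Mul u v w → Mul u v′ w → v ≡ v′
  Mul-cancelˡ (u∈ , v∈ , w∈ , eq) h@(_ , v′∈ , _) = ∙-cancelˡ (_ , u∈) (_ , v∈) (_ , v′∈) (trans eq (sym (Mul⇒≈ u∈ v′∈ w∈ h)))

  Mul-cancelʳ : ∀ {u u′ v w} → Mul u v w → Mul u′ v w → u ≡ u′
  Mul-cancelʳ (u∈ , v∈ , w∈ , eq) h@(u′∈ , _) = ∙-cancelʳ (_ , v∈) (_ , u∈) (_ , u′∈) (trans eq (sym (Mul⇒≈ u′∈ v∈ w∈ h)))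

  _∖_ : Subset A n → Subset A n → Subset A n
  (X ∖ Y) x = X x × ¬ Y x

  -- W itself need not be definable.
  Small : Subset A n → Set (Level.suc ℓ)
  Small W = Σ (Subset A n) λ W′ → W ⊆ W′ × HasDim< W′ [ k ]

  Small-⊆ : {V W : Subset A n} → V ⊆ W → Small W → Small V
  Small-⊆ V⊆W (W′ , W⊆W′ , h) = W′ , W⊆W′ ∘ V⊆W , h

  Small-∪ : {V W : Subset A n} → Small V → Small W → Small (V ∪ W)
  Small-∪ (V′ , V⊆V′ , h) (W′ , W⊆W′ , h′) =
    (V′ ∪ W′) , (λ { (inj₁ v) → inj₁ (V⊆V′ v) ; (inj₂ w) → inj₂ (W⊆W′ w) }) , HasDim<-∪ h h′

  U-not-Small : ¬ Small U
  U-not-Small (W′ , U⊆W′ , W′-def , d<k) =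
    <ᴰ-irrefl (⊔ᴰ-bound (HasDim-⊆ U⊆W′ dim-U (W′-def , refl)) d<k)

  Small⇒∃ : {W : Subset A n} → Small W → ∃ (U ∖ W)
  Small⇒∃ {W} W-small with em {P = ∃ (U ∖ W)}
  ... | yes h = h
  ... | no ¬h = contradiction (Small-⊆ U⊆W W-small) U-not-Small
    where
    U⊆W : U ⊆ W
    U⊆W {g} g∈ with em {P = W g}
    ... | yes w = w
    ... | no ¬w = contradiction (g , g∈ , ¬w) ¬h

  -- The map sending `v` to `v // c` is a definable injection; applied to the part of `W′` inside
  -- `U` it yields a cover of the preimage with unchanged dimension.
  Small-translate : {W : Subset A n} (c : ∃ U) → Small W →
                    Small (λ g → Σ (U g) λ g∈ → W (proj₁ ((g , g∈) ∙ c)))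
  Small-translate c (W′ , W⊆W′ , h) =
    Image R (λ v → U v × W′ v) ,
    (λ { {g} (g∈ , w) → proj₁ ((g , g∈) ∙ c) , (proj₂ ((g , g∈) ∙ c) , W⊆W′ w) , mul (g , g∈) c {(g , g∈) ∙ c} refl }) ,
    HasDim⇒HasDim<
      (HasDim-Image R (substᵈ₃ Mul Mul-def (dropᶜ n allᶜ) (constᶜ (proj₁ c)) (takeᶜ n allᶜ))
        (λ { {v} (v∈ , _) → proj₁ ((v , v∈) // c) ,
             mul ((v , v∈) // c) c {v , v∈} (//-rightDividesˡ c (v , v∈)) })
        (λ _ → Mul-cancelʳ) (λ _ _ → Mul-functional) (proj₁ UW′ , refl))
      (proj₂ UW′)
    where
    UW′ = HasDim<-⊆ proj₂ (U-def ∩ᵈ proj₁ h) h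
    R : Vec A n → Vec A n → Set ℓ
    R v g = Mul g (proj₁ c) v

  module _ {P : Subset A n} (P-def : Definable N P) (P⊆U : P ⊆ U) (U∖P-small : HasDim< (U ∖ P) [ k ]) where

    -- `U` is the union of `P` and a set of dimension below `k`, so the maximum in D2 is attained at
    -- `P`.
    dim-P : HasDim P [ k ]
    dim-P = P-def , ⊔ᴰ-dominant
      (HasDim-unique (HasDim-≐ ((λ { (inj₁ x) → P⊆U x ; (inj₂ (x , _)) → x }) , split) U-def
                               (D2 (P-def , refl) (proj₁ U∖P-small , refl))) dim-U)
      (proj₂ U∖P-small)
      where
      split : U ⊆ (P ∪ (U ∖ P))
      split {x} x∈ with em {P = P x}
      ... | yes y = inj₁ y
      ... | no ¬y = inj₂ (x∈ , ¬y)

    private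
      -- For `V` inside `U` this is the part of `V` that the translate of `P` by `b` leaves
      -- uncovered.
      Rest : Subset A n → Vec A n → Subset A n
      Rest V b w = V w × ∃ λ v → (U ∖ P) v × Mul b v w

      rest-def : {V : Subset A n} → Definable N V → Definable N ⟪ Rest V ⟫
      rest-def V-def = substᵈ V-def (dropᶜ n allᶜ) ∩ᵈ
        ∃ᵈ (substᵈ (proj₁ U∖P-small) newᶜ ∩ᵈ
            substᵈ₃ Mul Mul-def (oldᶜ (takeᶜ n allᶜ)) newᶜ (oldᶜ (dropᶜ n allᶜ)))

      fibre-def : {V : Subset A n} → Definable N V → ∀ b → Definable N (Rest V b)
      fibre-def {V} V-def b = substᵈ₂ (Rest V) (rest-def V-def) (constᶜ b) allᶜ

    -- If all translates bW of W = U ∖ P with b ∈ P met V in full dimension, {(b , w) : w ∈ V ∩ bW}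
    -- would have dimension k + dim V; but (b , w) ↦ (w , b⁻¹w) embeds it into V × W.
    translate-reduces : {V : Subset A n} {i : ℕ} → HasDim V [ i ] → ∃ λ b → P b × HasDim< (Rest V b) [ i ]
    translate-reduces {V} {i} dim-V with em {P = ∃ λ b → P b × HasDim< (Rest V b) [ i ]}
    ... | yes h = h
    ... | no ¬h = contradiction (⊔ᴰ-bound (HasDim-⊆ image⊆ (HasDim-Image R R-def total functional injective dim-T) dim-VW)
                    (subst (λ j → ([ i ] +ᴰ proj₁ dim-W) <ᴰ [ j ]) (+-comm i k) (+ᴰ-monoʳ-< i (proj₂ (proj₂ dim-W))))) <ᴰ-irrefl
      where
      dim-W : ∃ λ e → HasDim (U ∖ P) e × e <ᴰ [ k ]
      dim-W = _ , (proj₁ U∖P-small , refl) , proj₂ U∖P-small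

      full : ∀ b → P b → HasDim (Rest V b) [ i ]
      full b b∈ with em {P = HasDim (Rest V b) [ i ]}
      ... | yes y = y
      ... | no ¬y = contradiction (b , b∈ , fibre-def (proj₁ dim-V) b ,
            ⊔ᴰ-≢⇒< (HasDim-⊆ proj₁ (fibre-def (proj₁ dim-V) b , refl) dim-V) (λ eq → ¬y (_ , eq))) ¬h

      dim-T : HasDim ⟪ (λ b w → P b × Rest V b w) ⟫ [ k + i ]
      dim-T = HasDim-fibration (Rest V) (substᵈ P-def (takeᶜ n allᶜ) ∩ᵈ rest-def (proj₁ dim-V)) dim-P full

      dim-VW : HasDim ⟪ (λ w v → V w × (U ∖ P) v) ⟫ ([ i ] +ᴰ proj₁ dim-W)
      dim-VW = HasDim-fibration (λ _ → U ∖ P)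
        (substᵈ (proj₁ dim-V) (takeᶜ n allᶜ) ∩ᵈ substᵈ (proj₁ U∖P-small) (dropᶜ n allᶜ)) dim-V (λ _ _ → proj₁ (proj₂ dim-W))

      R : Vec A (n + n) → Vec A (n + n) → Set ℓ
      R bw wv = drop n bw ≡ take n wv × Mul (take n bw) (drop n wv) (drop n bw)

      R-def : Definable N ⟪ R ⟫
      R-def = ≡ᵈ (dropᶜ n (takeᶜ (n + n) allᶜ)) (takeᶜ n (dropᶜ (n + n) allᶜ)) ∩ᵈ
        substᵈ₃ Mul Mul-def (takeᶜ n (takeᶜ (n + n) allᶜ)) (dropᶜ n (dropᶜ (n + n) allᶜ)) (dropᶜ n (takeᶜ (n + n) allᶜ))

      total : ∀ {bw} → ⟪ (λ b w → P b × Rest V b w) ⟫ bw → ∃ (R bw)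
      total {bw} (_ , _ , v , _ , h) = drop n bw ++ v , sym (take-++ (drop n bw) v) ,
        subst (λ z → Mul (take n bw) z (drop n bw)) (sym (drop-++ (drop n bw) v)) h

      functional : ∀ {x y y′} → ⟪ (λ b w → P b × Rest V b w) ⟫ x → R x y → R x y′ → y ≡ y′
      functional _ (eq , h) (eq′ , h′) = take-drop-injective (trans (sym eq) eq′) (Mul-cancelˡ h h′)

      injective : ∀ {x x′ y} → ⟪ (λ b w → P b × Rest V b w) ⟫ x → ⟪ (λ b w → P b × Rest V b w) ⟫ x′ → R x y → R x′ y → x ≡ x′
      injective _ _ (eq , h) (eq′ , h′) =
        take-drop-injective (Mul-cancelʳ h (subst (Mul _ _) (trans eq′ (sym eq)) h′)) (trans eq (sym eq′))

      image⊆ : Image R ⟪ (λ b w → P b × Rest V b w) ⟫ ⊆ ⟪ (λ w v → V w × (U ∖ P) v) ⟫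
      image⊆ (_ , (_ , w∈ , v , v∈ , h) , eq , h′) = subst V eq w∈ , subst (U ∖ P) (Mul-cancelˡ h h′) v∈

    abstract
      -- Induction on a strict bound for the dimension of the set `V` still to be covered:
      -- `translate-reduces` supplies a translate whose uncovered rest has smaller dimension, and by
      -- D1 a set of dimension `⊥₋` is empty.
      finitely-many-translates : Σ (List (∃ P)) λ bs → ∀ {w} → U w → Any (λ b → ∃ λ v → P v × Mul (proj₁ b) v w) bs
      -- The bound is strict, hence the start at `suc k` for `U` of dimension `k`.
      finitely-many-translates = go (suc k) U-def (subst (_<ᴰ [ suc k ]) (HasDim-unique dim-U (U-def , refl)) [ n<1+n k ]) id
        where
        Covered : List (∃ P) → Vec A n → Set ℓ
        Covered bs w = Any (λ b → ∃ λ v → P v × Mul (proj₁ b) v w) bs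

        go : ∀ i {V} (V-def : Definable N V) → dim V-def <ᴰ [ i ] → V ⊆ U → Σ (List (∃ P)) λ bs → ∀ {w} → V w → Covered bs w
        go i {V} V-def V<i V⊆U with dim V-def in eq
        go i {V} V-def V<i V⊆U | ⊥₋ = [] , λ w∈ → contradiction w∈ (to (D1-empty V-def) (V-def , eq) _)
        go (suc i) {V} V-def [ s≤s j≤i ] V⊆U | [ j ] with translate-reduces (V-def , eq)
        ... | b , b∈ , rest , rest< with go i rest (lower rest<) (V⊆U ∘ proj₁)
          where
          lower : ∀ {d} → d <ᴰ [ j ] → d <ᴰ [ i ]
          lower ⊥₋<[ _ ] = ⊥₋<[ _ ]
          lower [ p ]    = [ <-≤-trans p j≤i ]
        ... | bs , covers = (b , b∈) ∷ bs , cover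
          where
          cover : ∀ {w} → V w → Covered ((b , b∈) ∷ bs) w
          -- The only candidate is `v = g ⁻¹ ∙ w′`: if it lies in `P`, the new translate covers `w`;
          -- otherwise `w` is in the rest.
          cover {w} w∈ = case em of λ
            { (yes v∈) → here (proj₁ v , v∈ , b∙v≡w)
            ; (no v∉)  → there (covers (w∈ , proj₁ v , (proj₂ v , v∉) , b∙v≡w)) }
            where
            g w′ v : Carrier
            g  = b , P⊆U b∈
            w′ = w , V⊆U w∈
            v  = g ⁻¹ ∙ w′
            b∙v≡w : Mul b (proj₁ v) w
            b∙v≡w = mul g v {w′} (\\-leftDividesˡ g w′)

-- Bad points of `X`, and generic membership in `Z`.

module GroupChunk {ℓ} (em : ExcludedMiddle ℓ)
    {L L′ : Language ℓ} {A : Set ℓ} (M : Structure L A) (N : Structure L′ A) (N⊒M : Expands N M)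
    (D : Dimension M N) {n} (U : Subset A n) (G : GroupOn ⌊ U ⌋) (G-def : DefinableGroup N G)
    (k : ℕ) (dim-U : Dimension.HasDim D U [ k ])
    {m} (X : Subset A m) (Z : Vec A m → Vec A m → Set ℓ)
    (X-def : Definable M X) (Z-def : Definable M ⟪ Z ⟫)
    (Z-large : Dimension.HasDim< D ⟪ (λ x y → (X x × X y) × ¬ Z x y) ⟫ [ 2 * k ])
    (h : ∃ X → ∃ U) (h-def : DefinableMap N ⌊ X ⌋ ⌊ U ⌋ h)
    (h-injective : Injective (Quotient._≈_ ⌊ X ⌋) (Quotient._≈_ ⌊ U ⌋) h)
    (h-large : Dimension.HasDim< D
      (λ g → Σ (U g) λ g∈U → ¬ (∃ λ x → Quotient._≈_ ⌊ U ⌋ (h x) (g , g∈U))) [ k ])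
    (F : ∃ X → ∃ X → ∃ X) (F-def : DefinableMap₂ M ⌊ X ⌋ ⌊ X ⌋ F)
    (h-homo : ∀ x y → Z (proj₁ x) (proj₁ y) →
      Quotient._≈_ ⌊ U ⌋ (GroupOn._∙_ G (h x) (h y)) (h (F x y))) where
  open Dimension D
  open GroupOn G using (group)
  open DimensionProperties D
  open GroupDimension em D G G-def k dim-U
  open Group group using (Carrier; _≈_; _∙_; ε; _⁻¹; ∙-cong; ⁻¹-cong; assoc; identityˡ; identityʳ)
  open GroupProperties group using (∙-cancelˡ; ∙-cancelʳ)

  h-cong : ∀ {x x′} → proj₁ x ≡ proj₁ x′ → h x ≈ h x′
  h-cong = DefinableMap.isMap h-def

  H : Vec A m → Vec A n → Set ℓ
  H x g = Σ (X x) λ x∈ → Σ (U g) λ g∈ → h (x , x∈) ≈ (g , g∈)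

  H-graph : ∀ x {g} → h x ≈ g → H (proj₁ x) (proj₁ g)
  H-graph x {g} eq = proj₂ x , proj₂ g , eq

  H⇒≈ : ∀ {x g} x∈ g∈ → H x g → h (x , x∈) ≈ (g , g∈)
  H⇒≈ _ _ (_ , _ , eq) = trans (h-cong refl) eq

  H-functional : ∀ {x g g′} → H x g → H x g′ → g ≡ g′
  H-functional (_ , _ , eq) hx = trans (sym eq) (H⇒≈ _ (proj₁ (proj₂ hx)) hx)

  H-injective : ∀ {x x′ g} → H x g → H x′ g → x ≡ x′
  H-injective (x∈ , _ , eq) (x′∈ , _ , eq′) = h-injective {_ , x∈} {_ , x′∈} (trans eq (sym eq′))

  Missed : Subset A n
  Missed g = Σ (U g) λ g∈U → ¬ (∃ λ x → h x ≈ (g , g∈U))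

  -- The slice of the complement of `Z` at second coordinate `t`. It keeps the coordinate `t`, which
  -- makes the slices disjoint, as (Ldef) and D3b require.
  NonZ : Vec A m → Subset A (m + m)
  NonZ t = ⟪ (λ a s → s ≡ t × X a × ¬ Z a t) ⟫

  -- For `t` in `X`, the map `h` embeds the slice into `G`, so `k` is its largest possible dimension
  -- and any other value means a small slice.
  Bad : Subset A m
  Bad t = X t × HasDim (NonZ t) [ k ]

  X′ : Subset A m
  X′ x = X x × ¬ Bad x

  NonZ-disjoint : ∀ {I : Subset A m} → Disjoint I NonZ
  NonZ-disjoint _ _ (refl , _) (refl , _) = refl

  module _ where
    open Definability M

    NonZ-def : {I : Subset A m} → Definable M I → Definable M ⟪ (λ t z → I t × NonZ t z) ⟫
    NonZ-def I-def =
      substᵈ I-def (takeᶜ m allᶜ) ∩ᵈ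
      ≡ᵈ (dropᶜ m (dropᶜ m allᶜ)) (takeᶜ m allᶜ) ∩ᵈ
      substᵈ X-def (takeᶜ m (dropᶜ m allᶜ)) ∩ᵈ
      ∁ᵈ (substᵈ₂ Z Z-def (takeᶜ m (dropᶜ m allᶜ)) (takeᶜ m allᶜ))

    Bad-def : Definable M Bad
    Bad-def = Ldef record { index = X-def ; total = NonZ-def X-def } NonZ-disjoint [ k ]

    X′-def : Definable M X′
    X′-def = X-def ∩ᵈ ∁ᵈ Bad-def

  -- The slices over `Bad` form a disjoint family of `k`-dimensional sets inside the complement of
  -- `Z`, so by D3b the dimension of `Bad` plus `k` is below `2 * k`.
  dim-Bad : HasDim< Bad [ k ]
  -- `2 * k` unfolds to `k + (k + 0)`, whence `+-identityʳ`.
  dim-Bad = Bad-defᴺ , +ᴰ-cancelʳ-< k (subst (λ j → (dim Bad-defᴺ +ᴰ [ k ]) <ᴰ [ k + j ]) (+-identityʳ k)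
    (⊔ᴰ-bound (HasDim-⊆ (λ { {z} (t , (t∈ , _) , refl , a∈ , ¬z) → (a∈ , t∈) , ¬z })
      (D3b record { index = Bad-defᴺ ; total = Definable-expand N⊒M (NonZ-def Bad-def) } NonZ-disjoint
           (Bad-defᴺ , refl) (λ _ → proj₂))
      (proj₁ Z-large , refl)) (proj₂ Z-large)))
    where
    Bad-defᴺ : Definable N Bad
    Bad-defᴺ = Definable-expand N⊒M Bad-def

  P : Subset A n
  P = Image H X′

  P⊆U : P ⊆ U
  P⊆U (_ , _ , _ , g∈ , _) = g∈

  module _ where
    open Definability N

    P-def : Definable N P
    P-def = ∃ᵈ (substᵈ (Definable-expand N⊒M X′-def) newᶜ ∩ᵈ substᵈ₂ H (DefinableMap.graph-definable h-def) newᶜ (oldᶜ allᶜ))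

    -- An element outside `P` is either missed by `h` or the image of a bad point, and `h` preserves
    -- the dimension of `Bad`.
    U∖P-small : HasDim< (U ∖ P) [ k ]
    U∖P-small = HasDim<-⊆ split (U-def ∩ᵈ ∁ᵈ P-def) (HasDim<-∪ h-large (HasDim⇒HasDim<
      (HasDim-Image H (DefinableMap.graph-definable h-def) (λ (x∈ , _) → _ , H-graph (_ , x∈) {h (_ , x∈)} refl)
         (λ _ → H-functional) (λ _ _ → H-injective) (proj₁ dim-Bad , refl)) (proj₂ dim-Bad)))
      where
      split : (U ∖ P) ⊆ (Missed ∪ Image H Bad)
      split {g} (g∈ , g∉P) with em {P = ∃ λ x → h x ≈ (g , g∈)}
      ... | no ¬p = inj₁ (g∈ , ¬p)
      ... | yes ((x , x∈) , eq) with em {P = Bad x}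
      ...   | yes b = inj₂ (x , b , x∈ , g∈ , eq)
      ...   | no ¬b = contradiction (x , (x∈ , ¬b) , x∈ , g∈ , eq) g∉P

    Missed-small : Small Missed
    Missed-small = _ , id , h-large

    -- An exceptional `g` is missed by `h` or comes from the slice at `x`. That slice has dimension
    -- at most `k` because its image lies in `U`, and not `k` because `x` is not bad.
    Z-generic : (x : ∃ X′) → Small (λ g → U g × ¬ ∃ λ a → H a g × Z a (proj₁ x))
    Z-generic (x , x∈ , ¬bad) = Small-⊆ split (Small-∪ Missed-small (Image R (NonZ x) , id , HasDim⇒HasDim< dim-image <k))
      where
      R : Vec A (m + m) → Vec A n → Set ℓ
      -- On `NonZ x` the second coordinate is constantly `x`, so the first alone determines the
      -- point and `R` is injective there.
      R z = H (take m z)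
      NonZ-defᴺ : Definable N (NonZ x)
      NonZ-defᴺ = ≡ᵈ (dropᶜ m allᶜ) (constᶜ x) ∩ᵈ substᵈ (Definable-expand N⊒M X-def) (takeᶜ m allᶜ) ∩ᵈ
        ∁ᵈ (substᵈ₂ Z (Definable-expand N⊒M Z-def) (takeᶜ m allᶜ) (constᶜ x))
      dim-image : HasDim (Image R (NonZ x)) (dim NonZ-defᴺ)
      dim-image = HasDim-Image R
        (substᵈ₂ H (DefinableMap.graph-definable h-def) (takeᶜ m (takeᶜ (m + m) allᶜ)) (dropᶜ (m + m) allᶜ))
        (λ (_ , a∈ , _) → _ , H-graph (_ , a∈) {h (_ , a∈)} refl) (λ _ → H-functional)
        (λ (eq , _) (eq′ , _) r r′ → take-drop-injective (H-injective r r′) (trans eq (sym eq′)))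
        (NonZ-defᴺ , refl)
      <k : dim NonZ-defᴺ <ᴰ [ k ]
      <k = ⊔ᴰ-≢⇒< (HasDim-⊆ (λ (_ , _ , _ , g∈ , _) → g∈) dim-image dim-U) (λ eq → ¬bad (x∈ , _ , eq))
      split : (λ g → U g × ¬ ∃ λ a → H a g × Z a x) ⊆ (Missed ∪ Image R (NonZ x))
      split {g} (g∈ , ¬p) with em {P = ∃ λ y → h y ≈ (g , g∈)}
      ... | no ¬q = inj₁ (g∈ , ¬q)
      ... | yes ((a , a∈) , eq) = inj₂ (a ++ x , (drop-++ a x , subst X (sym (take-++ a x)) a∈ , ¬z) ,
              subst (λ y → H y g) (sym (take-++ a x)) r)
        where
        r = a∈ , g∈ , eq
        ¬z : ¬ Z (take m (a ++ x)) x
        ¬z z = ¬p (a , r , subst (λ y → Z y x) (take-++ a x) z)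

  -- Chains of partial multiplications and equality of words.

  Step : Vec A m → Vec A m → Vec A m → Set ℓ
  Step a x c = Z a x × Σ (X a) λ a∈ → Σ (X x) λ x∈ → Σ (X c) λ c∈ → proj₁ (F (a , a∈) (x , x∈)) ≡ c

  Chain : Vec A m → List (Vec A m) → Vec A m → Set ℓ
  Chain a []       b = a ≡ b
  Chain a (x ∷ xs) b = ∃ λ c → Step a x c × Chain c xs b

  -- Only `X`, `Z` and `F` occur here, which gives definability in `M`; for words in `X′` the
  -- relation expresses equality of products in `G`.
  WordEq : List (Vec A m) → List (Vec A m) → Set ℓ
  WordEq xs ys = ∃ λ a → ∃ λ b → (X a × X b) × Chain a xs b × Chain a ys b

  module _ where
    open Definability M

    Step-def : Definable M ⟪ Step ⟫₃
    Step-def = substᵈ₂ Z Z-def (takeᶜ m allᶜ) (takeᶜ m (dropᶜ m allᶜ)) ∩ᵈ DefinableMap₂.graph-definable F-def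

    -- The length of the word is fixed outside the formula, so one existential block per letter
    -- suffices. The letters live over `E`; `π` and `w` carry them into the context `E′`, which
    -- grows by one block at each step.
    Chain-def : ∀ {E E′ : Set ℓ} {i j} {V : E → Vec A i} {V′ : E′ → Vec A j} {ts : List (E → Vec A m)} →
                All (Coordinates V) ts →
                (π : E′ → E) → (∀ {t : E → Vec A m} → Coordinates V t → Coordinates V′ (t ∘ π)) →
                ∀ {s u : E′ → Vec A m} → Coordinates V′ s → Coordinates V′ u →
                Def V′ (λ e → Chain (s e) (map (λ t → t (π e)) ts) (u e))
    Chain-def []       π w s u = ≡ᵈ s u
    Chain-def (t ∷ ts) π w s u =
      ∃ᵈ (substᵈ₃ Step Step-def (oldᶜ s) (oldᶜ (w t)) newᶜ ∩ᵈ Chain-def ts (π ∘ proj₂) (oldᶜ ∘ w) newᶜ (oldᶜ u))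

    WordEq-def : ∀ {E : Set ℓ} {i} {V : E → Vec A i} {ss ts : List (E → Vec A m)} →
                 All (Coordinates V) ss → All (Coordinates V) ts →
                 Def V (λ e → WordEq (map (λ t → t e) ss) (map (λ t → t e) ts))
    WordEq-def ss ts = ∃ᵈ (∃ᵈ ((substᵈ X-def (oldᶜ newᶜ) ∩ᵈ substᵈ X-def newᶜ) ∩ᵈ
      Chain-def ss (proj₂ ∘ proj₂) (oldᶜ ∘ oldᶜ) (oldᶜ newᶜ) newᶜ ∩ᵈ
      Chain-def ts (proj₂ ∘ proj₂) (oldᶜ ∘ oldᶜ) (oldᶜ newᶜ) newᶜ))

  h′ : ∃ X′ → Carrier
  h′ (x , x∈ , _) = h (x , x∈)

  prod : List (∃ X′) → Carrier
  prod []       = ε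
  prod (x ∷ xs) = h′ x ∙ prod xs

  Chain-sound : ∀ xs {a b} (a∈ : X a) (b∈ : X b) → Chain a (map proj₁ xs) b → h (a , a∈) ∙ prod xs ≈ h (b , b∈)
  Chain-sound []       a∈ b∈ eq = trans (identityʳ (h (_ , a∈))) (h-cong eq)
  Chain-sound (x@(x₀ , x∈ , _) ∷ xs) {a} a∈ b∈ (c , (z , a∈′ , x∈′ , c∈ , eq) , chain) =
    trans (sym (assoc (h (a , a∈)) (h′ x) (prod xs)))
      (trans (∙-cong {y = h (c , c∈)} {v = prod xs}
               -- The step carries its own membership proofs; they are exchanged before `h-homo`
               -- applies.
               (trans (∙-cong {h (a , a∈)} {h (a , a∈′)} {h′ x} {h (x₀ , x∈′)} (h-cong refl) (h-cong refl))
                      (trans (h-homo (a , a∈′) (x₀ , x∈′) z) (h-cong eq))) refl)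
             (Chain-sound xs c∈ b∈ chain))

  -- A chain from `g` fails either at the first letter, which is rare by `Z-generic`, or later, and
  -- then `g ∙ h′ x` is exceptional for the shorter word; translation keeps that set small.
  Chain-generic : (xs : List (∃ X′)) → Small (λ g → U g × ¬ ∃ λ a → H a g × ∃ λ b → X b × Chain a (map proj₁ xs) b)
  Chain-generic [] =
    Small-⊆ (λ (g∈ , ¬p) → g∈ , λ ((x , x∈) , eq) → ¬p (x , (x∈ , g∈ , eq) , x , x∈ , refl)) Missed-small
  Chain-generic (x@(x₀ , x∈ , _) ∷ xs) =
    Small-⊆ split (Small-∪ (Z-generic x) (Small-translate (h′ x) (Chain-generic xs)))
    where
    split : (λ g → U g × ¬ ∃ λ a → H a g × ∃ λ b → X b × Chain a (x₀ ∷ map proj₁ xs) b) ⊆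
            ((λ g → U g × ¬ ∃ λ a → H a g × Z a x₀) ∪
             (λ g → Σ (U g) λ g∈ → let g′ = proj₁ ((g , g∈) ∙ h′ x) in
                    U g′ × ¬ ∃ λ a → H a g′ × ∃ λ b → X b × Chain a (map proj₁ xs) b))
    split {g} (g∈ , ¬p) with em {P = ∃ λ a → H a g × Z a x₀}
    ... | no ¬q = inj₁ (g∈ , ¬q)
    -- The chain for `xs` starts at a preimage `c` of `g ∙ h′ x`; by injectivity of `h` it is the
    -- value of `F` at `a` and `x`, so the two parts fit together.
    ... | yes (a , r@(a∈ , _ , eq) , z) = inj₂ (g∈ , proj₂ ((g , g∈) ∙ h′ x) , λ (c , s@(c∈ , _) , b , b∈ , chain) →
      ¬p (a , r , b , b∈ , c , (z , a∈ , x∈ , c∈ , H-injective {g = proj₁ ((g , g∈) ∙ h′ x)} step s) , chain))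
      where
      step : H (proj₁ (F (a , a∈) (x₀ , x∈))) (proj₁ ((g , g∈) ∙ h′ x))
      step = H-graph (F (a , a∈) (x₀ , x∈)) {(g , g∈) ∙ h′ x}
        (trans (sym (h-homo (a , a∈) (x₀ , x∈) z)) (∙-cong {h (a , a∈)} {g , g∈} {h′ x} {h′ x} (H⇒≈ a∈ g∈ r) refl))

  -- Soundness cancels `h` of the common starting point. Conversely a generic starting point admits
  -- chains along both words, and injectivity of `h` makes their ends equal when the products are.
  WordEq⇔≈ : ∀ xs ys → WordEq (map proj₁ xs) (map proj₁ ys) ⇔ (prod xs ≈ prod ys)
  WordEq⇔≈ xs ys = mk⇔
    (λ (a , b , (a∈ , b∈) , cx , cy) → ∙-cancelˡ (h (a , a∈)) (prod xs) (prod ys)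
      (trans (Chain-sound xs a∈ b∈ cx) (sym (Chain-sound ys a∈ b∈ cy))))
    complete
    where
    complete : prod xs ≈ prod ys → WordEq (map proj₁ xs) (map proj₁ ys)
    complete eq with Small⇒∃ (Small-∪ (Chain-generic xs) (Chain-generic ys))
    ... | g , g∈ , ¬p
      with em {P = ∃ λ a → H a g × ∃ λ b → X b × Chain a (map proj₁ xs) b}
         | em {P = ∃ λ a → H a g × ∃ λ b → X b × Chain a (map proj₁ ys) b}
    ... | no ¬q | _ = contradiction (inj₁ (g∈ , ¬q)) ¬p
    ... | yes _ | no ¬q = contradiction (inj₂ (g∈ , ¬q)) ¬p
    ... | yes (a , r@(a∈ , _) , b , b∈ , cx) | yes (a′ , r′ , b′ , b′∈ , cy) with H-injective r r′
    -- Both chains start at the one preimage of `g`.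
    ...   | refl = a , b , (a∈ , b∈) , cx , subst (Chain a (map proj₁ ys)) (sym b≡b′) cy
      where
      b≡b′ : b ≡ b′
      b≡b′ = h-injective {b , b∈} {b′ , b′∈}
        (trans (sym (Chain-sound xs a∈ b∈ cx))
          (trans (∙-cong {h (a , a∈)} {h (a , a∈)} {prod xs} {prod ys} refl eq) (Chain-sound ys a∈ b′∈ cy)))

  prod-++ : ∀ xs ys → prod (xs ++ˡ ys) ≈ prod xs ∙ prod ys
  prod-++ []       ys = sym (identityˡ (prod ys))
  prod-++ (x ∷ xs) ys =
    trans (∙-cong {h′ x} {h′ x} {prod (xs ++ˡ ys)} {prod xs ∙ prod ys} refl (prod-++ xs ys))
          (sym (assoc (h′ x) (prod xs) (prod ys)))

  -- Unique representatives of the elements of `G` by pairs.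

  -- Discarding pairs whose value is already attained makes (b , x) ↦ h(b)h(x) injective.
  Rep : List (∃ X′) → Vec A m → Vec A m → Set ℓ
  Rep []       b x = ⊥
  Rep (c ∷ bs) b x = Rep bs b x ⊎
    (b ≡ proj₁ c × X′ x × ¬ (∃ λ b′ → ∃ λ x′ → Rep bs b′ x′ × WordEq (b ∷ x ∷ []) (b′ ∷ x′ ∷ [])))

  Rep-def : ∀ bs → Definable M ⟪ Rep bs ⟫
  Rep-def []       = ∅ᵈ
    where open Definability M
  Rep-def (c ∷ bs) =
    Rep-def bs ∪ᵈ
    ≡ᵈ (takeᶜ m allᶜ) (constᶜ (proj₁ c)) ∩ᵈ substᵈ X′-def (dropᶜ m allᶜ) ∩ᵈ
    ∁ᵈ (∃ᵈ (∃ᵈ (substᵈ₂ (Rep bs) (Rep-def bs) (oldᶜ newᶜ) newᶜ ∩ᵈ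
      WordEq-def (oldᶜ (oldᶜ (takeᶜ m allᶜ)) ∷ oldᶜ (oldᶜ (dropᶜ m allᶜ)) ∷ []) (oldᶜ newᶜ ∷ newᶜ ∷ []))))
    where open Definability M

  Rep⇒X′ : ∀ bs {b x} → Rep bs b x → X′ b × X′ x
  Rep⇒X′ (c ∷ bs) (inj₁ r)             = Rep⇒X′ bs r
  Rep⇒X′ (c ∷ bs) (inj₂ (refl , x∈ , _)) = proj₂ c , x∈

  pair : ∀ {b x} → X′ b × X′ x → List (∃ X′)
  pair (b∈ , x∈) = (_ , b∈) ∷ (_ , x∈) ∷ []

  prod-pair-cong : ∀ {b x b′ x′} (p : X′ b × X′ x) (q : X′ b′ × X′ x′) → b ≡ b′ → x ≡ x′ → prod (pair p) ≈ prod (pair q)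
  prod-pair-cong (b∈ , x∈) (b′∈ , x′∈) eq eq′ =
    ∙-cong {h′ (_ , b∈)} {h′ (_ , b′∈)} {h′ (_ , x∈) ∙ ε} {h′ (_ , x′∈) ∙ ε} (h-cong eq)
      (∙-cong {h′ (_ , x∈)} {h′ (_ , x′∈)} {ε} {ε} (h-cong eq′) refl)

  -- Pairs kept at different stages differ in value by the newness clause; pairs of one stage share
  -- the factor `h′ c`, which cancels.
  Rep-injective : ∀ bs {b x b′ x′} → Rep bs b x → Rep bs b′ x′ →
                  WordEq (b ∷ x ∷ []) (b′ ∷ x′ ∷ []) → b ≡ b′ × x ≡ x′
  Rep-injective (c ∷ bs) (inj₁ r) (inj₁ r′) eq = Rep-injective bs r r′ eq
  Rep-injective (c ∷ bs) (inj₁ r) (inj₂ (_ , _ , new)) (a , d , ad∈ , p , q) =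
    -- Newness is stated with the later pair first, so the two chains are exchanged.
    contradiction (_ , _ , r , a , d , ad∈ , q , p) new
  Rep-injective (c ∷ bs) (inj₂ (_ , _ , new)) (inj₁ r′) eq = contradiction (_ , _ , r′ , eq) new
  Rep-injective (c ∷ bs) (inj₂ (refl , x∈ , _)) (inj₂ (refl , x′∈ , _)) eq =
    refl , h-injective {_ , proj₁ x∈} {_ , proj₁ x′∈}
      (∙-cancelʳ ε (h′ (_ , x∈)) (h′ (_ , x′∈)) (∙-cancelˡ (h′ c) (h′ (_ , x∈) ∙ ε) (h′ (_ , x′∈) ∙ ε)
        (to (WordEq⇔≈ (pair (proj₂ c , x∈)) (pair (proj₂ c , x′∈))) eq)))

  -- If the pair found for `g` was discarded, the kept pair responsible for this has the same value
  -- and replaces it.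
  Rep-complete : ∀ bs {g} → Any (λ b → ∃ λ x → prod (b ∷ x ∷ []) ≈ g) bs →
                 ∃ λ b → ∃ λ x → Σ (Rep bs b x) λ r → prod (pair (Rep⇒X′ bs r)) ≈ g
  Rep-complete (c ∷ bs) (here ((x , x∈) , eq))
    with em {P = ∃ λ b′ → ∃ λ x′ → Rep bs b′ x′ × WordEq (proj₁ c ∷ x ∷ []) (b′ ∷ x′ ∷ [])}
  ... | no new = proj₁ c , x , inj₂ (refl , x∈ , new) , eq
  ... | yes (b′ , x′ , r , eq′) =
    b′ , x′ , inj₁ r , trans (sym (to (WordEq⇔≈ (pair (proj₂ c , x∈)) (pair (Rep⇒X′ bs r))) eq′)) eq
  Rep-complete (c ∷ bs) {g} (there any) with Rep-complete bs {g} any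
  ... | b , x , r , eq = b , x , inj₁ r , eq

  -- The finitely many translating elements lie in `P`, the image of `X′`, so they can be pulled
  -- back along `h`.
  generators : Σ (List (∃ X′)) λ bs → ∀ g → Any (λ b → ∃ λ x → prod (b ∷ x ∷ []) ≈ g) bs
  generators = map (λ (_ , x , x∈ , _) → x , x∈) (proj₁ translates) ,
    λ g → map⁺ (Any.map (λ {b} → convert g b) (proj₂ translates (proj₂ g)))
    where
    translates : Σ (List (∃ P)) λ bs → ∀ {w} → U w → Any (λ b → ∃ λ v → P v × Mul (proj₁ b) v w) bs
    translates = finitely-many-translates P-def P⊆U U∖P-small

    convert : ∀ g (b : ∃ P) → ∃ (λ v → P v × Mul (proj₁ b) v (proj₁ g)) →
              ∃ λ x → prod ((proj₁ (proj₂ b) , proj₁ (proj₂ (proj₂ b))) ∷ x ∷ []) ≈ g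
    convert g (u , b , b∈ , rb@(_ , u∈ , _)) (v , (x , x∈ , rx@(_ , v∈ , _)) , uv) =
      (x , x∈) , trans
        (∙-cong {h′ (b , b∈)} {u , u∈} {h′ (x , x∈) ∙ ε} {v , v∈} (H⇒≈ (proj₁ b∈) u∈ rb)
          (trans (identityʳ (h′ (x , x∈))) (H⇒≈ (proj₁ x∈) v∈ rx)))
        (Mul⇒≈ u∈ v∈ (proj₂ g) uv)

  -- The group structure transported to the representatives.

  module Representatives (bs : List (∃ X′)) (covers : ∀ g → Any (λ b → ∃ λ x → prod (b ∷ x ∷ []) ≈ g) bs) where

    Y : Subset A (m + m)
    Y = ⟪ Rep bs ⟫

    open Quotient ⌊ Y ⌋ using () renaming (_≈_ to _≈ʸ_)

    word : ∃ Y → List (∃ X′)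
    word (_ , r) = pair (Rep⇒X′ bs r)

    φ : ∃ Y → Carrier
    φ y = prod (word y)

    φ-cong : ∀ {y y′} → y ≈ʸ y′ → φ y ≈ φ y′
    φ-cong {y , r} {y′ , r′} eq = prod-pair-cong (Rep⇒X′ bs r) (Rep⇒X′ bs r′) (cong (take m) eq) (cong (drop m) eq)

    φ-injective : ∀ {y y′} → φ y ≈ φ y′ → y ≈ʸ y′
    φ-injective {y} {y′} eq = take-drop-injective (proj₁ eqs) (proj₂ eqs)
      where
      eqs : take m (proj₁ y) ≡ take m (proj₁ y′) × drop m (proj₁ y) ≡ drop m (proj₁ y′)
      eqs = Rep-injective bs (proj₂ y) (proj₂ y′) (from (WordEq⇔≈ (word y) (word y′)) eq)

    private
      code : ∀ g → (∃ λ b → ∃ λ x → Σ (Rep bs b x) λ r → prod (pair (Rep⇒X′ bs r)) ≈ g) → Σ (∃ Y) λ y → φ y ≈ g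
      code g (b , x , r , eq) = (b ++ x , r′) ,
        trans (prod-pair-cong (Rep⇒X′ bs r′) (Rep⇒X′ bs r) (take-++ b x) (drop-++ b x)) eq
        where
        r′ : Y (b ++ x)
        r′ = subst₂ (Rep bs) (sym (take-++ b x)) (sym (drop-++ b x)) r

    ψ : Carrier → ∃ Y
    ψ g = proj₁ (code g (Rep-complete bs {g} (covers g)))

    φ∘ψ : ∀ g → φ (ψ g) ≈ g
    φ∘ψ g = proj₂ (code g (Rep-complete bs {g} (covers g)))

    rawGroup : RawGroup ℓ ℓ
    rawGroup = record
      { Carrier = ∃ Y ; _≈_ = _≈ʸ_ ; _∙_ = λ y z → ψ (φ y ∙ φ z) ; ε = ψ ε ; _⁻¹ = λ y → ψ (φ y ⁻¹) }

    -- Through this embedding the group axioms on `Y` are inherited from `G`.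
    φ-isGroupMonomorphism : GroupMorphisms.IsGroupMonomorphism rawGroup (GroupOn.rawGroup G) φ
    φ-isGroupMonomorphism = record
      { isGroupHomomorphism = record
        { isMonoidHomomorphism = record
          { isMagmaHomomorphism = record
            { isRelHomomorphism = record { cong = λ {y} {z} → φ-cong {y} {z} }
            ; homo = λ y z → φ∘ψ (φ y ∙ φ z) }
          ; ε-homo = φ∘ψ ε }
        ; ⁻¹-homo = λ y → φ∘ψ (φ y ⁻¹) }
      ; injective = λ {y} {z} → φ-injective {y} {z} }

    groupOnY : GroupOn ⌊ Y ⌋
    groupOnY = record { isGroup = GroupMonomorphism.isGroup φ-isGroupMonomorphism (GroupOn.isGroup G) }

    open GroupOn groupOnY using () renaming (_∙_ to _∙ʸ_)

    -- The product of `y` and `z` is `w` exactly when the four-letter word of `y` and `z` equals the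
    -- two-letter word of `w`; by `WordEq⇔≈` this is expressible in `M`.
    ∙ʸ-definable : Definable M (Graph₂ ⌊ Y ⌋ ⌊ Y ⌋ _∙ʸ_)
    ∙ʸ-definable = Def-cong
      (λ e → mk⇔
        (λ (y∈ , z∈ , w∈ , eq) → y∈ , z∈ , w∈ , from (WordEq⇔≈ (word (_ , y∈) ++ˡ word (_ , z∈)) (word (_ , w∈)))
          (trans (prod-++ (word (_ , y∈)) (word (_ , z∈)))
            (trans (sym (φ∘ψ (φ (_ , y∈) ∙ φ (_ , z∈)))) (φ-cong {(_ , y∈) ∙ʸ (_ , z∈)} {_ , w∈} eq))))
        (λ (y∈ , z∈ , w∈ , eq) → y∈ , z∈ , w∈ , φ-injective {(_ , y∈) ∙ʸ (_ , z∈)} {_ , w∈}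
          (trans (φ∘ψ (φ (_ , y∈) ∙ φ (_ , z∈))) (trans (sym (prod-++ (word (_ , y∈)) (word (_ , z∈))))
            (to (WordEq⇔≈ (word (_ , y∈) ++ˡ word (_ , z∈)) (word (_ , w∈))) eq)))))
      (substᵈ (Rep-def bs) y ∩ᵈ substᵈ (Rep-def bs) z ∩ᵈ substᵈ (Rep-def bs) w ∩ᵈ
       WordEq-def (takeᶜ m y ∷ dropᶜ m y ∷ takeᶜ m z ∷ dropᶜ m z ∷ []) (takeᶜ m w ∷ dropᶜ m w ∷ []))
      where
      open Definability M
      y = takeᶜ (m + m) allᶜ
      z = takeᶜ (m + m) (dropᶜ (m + m) allᶜ)
      w = dropᶜ (m + m) (dropᶜ (m + m) allᶜ)

    definableGroup : DefinableGroup M groupOnY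
    definableGroup = record
      { universe-definable = Rep-def bs
      ; ∙-definable = record
        { isMap₂ = λ {x} {x′} {y} {y′} → Group.∙-cong (GroupOn.group groupOnY) {x} {x′} {y} {y′}
        ; graph-definable = ∙ʸ-definable } }

    interpretableGroup : InterpretableGroup M groupOnY
    interpretableGroup = record
      { universe-definable = record
        { universe-definable = Rep-def bs
        ; ∼-definable = substᵈ (Rep-def bs) (takeᶜ (m + m) allᶜ) ∩ᵈ substᵈ (Rep-def bs) (dropᶜ (m + m) allᶜ) ∩ᵈ
                        ≡ᵈ (takeᶜ (m + m) allᶜ) (dropᶜ (m + m) allᶜ) }
      ; ∙-definable = DefinableGroup.∙-definable definableGroup }
      where open Definability M

    ψ-cong : ∀ {g g′} → g ≈ g′ → ψ g ≈ʸ ψ g′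
    ψ-cong {g} {g′} eq = φ-injective {ψ g} {ψ g′} (trans (φ∘ψ g) (trans eq (sym (φ∘ψ g′))))

    ψ∘φ : ∀ y → ψ (φ y) ≈ʸ y
    ψ∘φ y = φ-injective {ψ (φ y)} {y} (φ∘ψ (φ y))

    ψ-isGroupIsomorphism : GroupMorphisms.IsGroupIsomorphism (GroupOn.rawGroup G) (GroupOn.rawGroup groupOnY) ψ
    ψ-isGroupIsomorphism = record
      { isGroupMonomorphism = record
        { isGroupHomomorphism = record
          { isMonoidHomomorphism = record
            { isMagmaHomomorphism = record
              { isRelHomomorphism = record { cong = λ {g} {g′} → ψ-cong {g} {g′} }
              ; homo = λ g g′ → ψ-cong {g ∙ g′} {φ (ψ g) ∙ φ (ψ g′)}
                         (∙-cong {g} {φ (ψ g)} {g′} {φ (ψ g′)} (sym (φ∘ψ g)) (sym (φ∘ψ g′))) }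
            ; ε-homo = refl }
          ; ⁻¹-homo = λ g → ψ-cong {g ⁻¹} {φ (ψ g) ⁻¹} (⁻¹-cong {g} {φ (ψ g)} (sym (φ∘ψ g))) }
        ; injective = λ {g} {g′} eq → trans (sym (φ∘ψ g)) (trans (φ-cong {ψ g} {ψ g′} eq) (φ∘ψ g′)) }
      ; surjective = λ y → φ y , λ {g} eq → trans (ψ-cong {g} {φ y} eq) (ψ∘φ y) }

    -- The graph consists of all `g` and `(b , x)` in `Y` with `h(b)h(x) = g`, a condition on the
    -- graphs of `h` and of the multiplication, both definable in `N`.
    ψ-definable : Definable N (Graph ⌊ U ⌋ ⌊ Y ⌋ ψ)
    ψ-definable = Def-cong
      (λ e → mk⇔
        (λ (g∈ , y∈ , eq) → g∈ , y∈ ,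
          let b∈ , x∈ = Rep⇒X′ bs y∈ ; b = _ , proj₁ b∈ ; x = _ , proj₁ x∈ in
          proj₁ (h b) , proj₁ (h x) , H-graph b {h b} refl , H-graph x {h x} refl ,
          mul (h b) (h x) {_ , g∈} (trans (sym (φ-value y∈))
            (trans (sym (φ-cong {ψ (_ , g∈)} {_ , y∈} eq)) (φ∘ψ (_ , g∈)))))
        (λ (g∈ , y∈ , u , v , rb@(_ , u∈ , _) , rx@(_ , v∈ , _) , uv) → g∈ , y∈ ,
          let b∈ , x∈ = Rep⇒X′ bs y∈ ; b = _ , proj₁ b∈ ; x = _ , proj₁ x∈ in
          φ-injective {ψ (_ , g∈)} {_ , y∈} (trans (φ∘ψ (_ , g∈)) (trans (sym (Mul⇒≈ u∈ v∈ g∈ uv))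
            (trans (∙-cong {u , u∈} {h b} {v , v∈} {h x} (sym (H⇒≈ (proj₁ b∈) u∈ rb)) (sym (H⇒≈ (proj₁ x∈) v∈ rx)))
              (sym (φ-value y∈)))))))
      (substᵈ U-def g ∩ᵈ substᵈ (Definable-expand N⊒M (Rep-def bs)) y ∩ᵈ
       ∃ᵈ (∃ᵈ (substᵈ₂ H H-def (oldᶜ (oldᶜ (takeᶜ m y))) (oldᶜ newᶜ) ∩ᵈ
               substᵈ₂ H H-def (oldᶜ (oldᶜ (dropᶜ m y))) newᶜ ∩ᵈ
               substᵈ₃ Mul Mul-def (oldᶜ newᶜ) newᶜ (oldᶜ (oldᶜ g)))))
      where
      open Definability N
      H-def : Definable N ⟪ H ⟫
      H-def = DefinableMap.graph-definable h-def
      g = takeᶜ n allᶜ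
      y = dropᶜ n allᶜ
      φ-value : ∀ {y} (y∈ : Y y) → φ (y , y∈) ≈ h′ (_ , proj₁ (Rep⇒X′ bs y∈)) ∙ h′ (_ , proj₂ (Rep⇒X′ bs y∈))
      φ-value y∈ = let b∈ , x∈ = Rep⇒X′ bs y∈ in
        ∙-cong {h′ (_ , b∈)} {h′ (_ , b∈)} {h′ (_ , x∈) ∙ ε} {h′ (_ , x∈)} refl (identityʳ (h′ (_ , x∈)))

    definablyIsomorphic : DefinablyIsomorphic N G groupOnY
    definablyIsomorphic = ψ , ψ-isGroupIsomorphism , record
      { isMap = λ {g} {g′} → ψ-cong {g} {g′} ; graph-definable = ψ-definable }

theorem4p4 : ∀ {ℓ} → ExcludedMiddle ℓ →
  {L L′ : Language ℓ} {A : Set ℓ} (M : Structure L A) (N : Structure L′ A) → Expands N M →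
  (D : Dimension M N) → let open Dimension D in
  ∀ {n} (U : Subset A n) (G : GroupOn ⌊ U ⌋) → DefinableGroup N G →
  let open GroupOn G in let open Quotient ⌊ U ⌋ using (_≈_) in
  (k : ℕ) → HasDim U [ k ] →
  -- (i)
  ∀ {m} (X : Subset A m) (Z : Vec A m → Vec A m → Set ℓ) →
  Definable M X → Definable M ⟪ Z ⟫ → (∀ {x y} → Z x y → X x × X y) →
  HasDim< ⟪ (λ x y → (X x × X y) × ¬ Z x y) ⟫ [ 2 * k ] →
  -- (ii)
  (h : ∃ X → ∃ U) → DefinableMap N ⌊ X ⌋ ⌊ U ⌋ h →
  Injective (Quotient._≈_ ⌊ X ⌋) _≈_ h →
  HasDim< (λ g → Σ (U g) λ g∈U → ¬ (∃ λ x → h x ≈ (g , g∈U))) [ k ] →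
  -- (iii)
  (F : ∃ X → ∃ X → ∃ X) → DefinableMap₂ M ⌊ X ⌋ ⌊ X ⌋ F →
  (∀ x y → Z (proj₁ x) (proj₁ y) → h x ∙ h y ≈ h (F x y)) →
  (∃ λ r → Σ (Quotient A r) λ Q → Σ (GroupOn Q) λ H →
    InterpretableGroup M H × DefinablyIsomorphic N G H)
  ×
  (OMinimal M →
    ∃ λ r → Σ (Subset A r) λ Y → Σ (GroupOn ⌊ Y ⌋) λ H →
    DefinableGroup M H × DefinablyIsomorphic N G H)
theorem4p4 em M N N⊒M D U G G-def k dim-U X Z X-def Z-def Z⊆X² Z-large h h-def h-injective h-large F F-def h-homo =
  (_ , ⌊ Y ⌋ , groupOnY , interpretableGroup , definablyIsomorphic) ,
  λ _ → _ , Y , groupOnY , definableGroup , definablyIsomorphic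
  where
  open GroupChunk em M N N⊒M D U G G-def k dim-U X Z X-def Z-def Z-large h h-def h-injective h-large F F-def h-homo
  open Representatives (proj₁ generators) (proj₂ generators)
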